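{- Let $\sigma$ be a countable signature. Let $L(\sigma)$ be the least set of formulas containing all atomic first-order $\sigma$-formulas and a new atomic sentence $P$ and closed under the first-order connectives and quantifiers. Define $\models_{L(\sigma)}$ as for first-order logic, with the additional clause $\mathcal M\models_{L(\sigma)}P$ if and only if $|\mathrm{Aut}(\mathcal M)|\leq2^{\aleph_0}$. Then $L(\sigma)>FO(\sigma)$, and $L(\sigma)$ has the $\aleph_0$-compactness property.
   Context: $\mathrm{Aut}(\mathcal M)$ is the automorphism group of $\mathcal M$. For an abstract logic $L(\sigma)$ (a set of sentences with an isomorphism-invariant satisfaction relation to $\sigma$-structures), a class of structures is expressible if some sentence is satisfied exactly by its members; $L(\sigma)\geq FO(\sigma)$ means every class expressible in first-order logic is expressible in $L(\sigma)$, and $L(\sigma)>FO(\sigma)$ means additionally that some class expressible in $L(\sigma)$ is not first-order expressible. $\aleph_0$-compactness: every countable set of sentences all of whose finite subsets have a model has a model. -}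

module Defs where

open import Algebra.Bundles using (Group)
open import Data.Bool.Base using (Bool)
open import Data.Empty using (⊥)
open import Data.Fin.Base using (Fin)
open import Data.List.Base using (List)
open import Data.List.Relation.Unary.All using (All)
open import Data.Nat.Base using (ℕ; suc)
open import Data.Product.Base as Product using (Σ; ∃-syntax; _×_; _,_)
open import Data.Sum.Base as Sum using (_⊎_)
open import Data.Vec.Base using (Vec; []; _∷_; lookup; map)
open import Data.Vec.Relation.Binary.Pointwise.Inductive as PW
  using (Pointwise; []; _∷_)
open import Function.Base using (_∘_; id)
open import Function.Bundles using (Injection; Inverse; Equivalence; _↣_; _⇔_; mk⇔)
import Function.Construct.Composition as Compose
import Function.Construct.Identity as Identity
import Function.Construct.Symmetry as Symmetry
open import Level using (0ℓ)
open import Relation.Binary.Bundles using (Setoid)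
open import Relation.Binary.PropositionalEquality using (_≡_; _→-setoid_)
open import Relation.Nullary.Negation.Core using (¬_)
open import Relation.Unary using (Pred; _∈_)

-- Cardinalities.  As there are no quotient types, sets are setoids, and
-- |A| ≤ |B| means that some map A → B respects and reflects equality.

_≼_ : Setoid 0ℓ 0ℓ → Setoid 0ℓ 0ℓ → Set
A ≼ B = Injection A B

-- 2^ℵ₀: functions ℕ → Bool up to pointwise equality.
Continuum : Setoid 0ℓ 0ℓ
Continuum = ℕ →-setoid Bool

-- Finite or countably infinite.
Countable : Set → Set
Countable A = A ↣ ℕ

record Signature : Set₁ where
  field
    Fun : Set
    Rel : Set
    funArity : Fun → ℕ
    relArity : Rel → ℕ

open Signature public

CountableSignature : Signature → Set
CountableSignature σ = Countable (Fun σ) × Countable (Rel σ)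

module _ (σ : Signature) where

  -- The equality symbol is interpreted as the setoid equality _≈_.  The
  -- inhabitant only records that the domain is nonempty: no notion below
  -- depends on which element it is.
  record Structure : Set₁ where
    field
      domain : Setoid 0ℓ 0ℓ
    open Setoid domain public
    field
      inhabitant : Carrier
      fun : (f : Fun σ) → Vec Carrier (funArity σ f) → Carrier
      fun-cong : ∀ f {xs ys} → Pointwise _≈_ xs ys → fun f xs ≈ fun f ys
      rel : (r : Rel σ) → Vec Carrier (relArity σ r) → Set
      rel-cong : ∀ r {xs ys} → Pointwise _≈_ xs ys → rel r xs → rel r ys

  -- Terms and formulas with free variables among n (de Bruijn indices).
  data Term (n : ℕ) : Set where
    var : Fin n → Term n
    app : (f : Fun σ) → Vec (Term n) (funArity σ f) → Term n

  -- First-order formulas over σ, with each element of X as an additional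
  -- atomic sentence.
  data Formula (X : Set) (n : ℕ) : Set where
    extra   : X → Formula X n
    equal   : Term n → Term n → Formula X n
    atom    : (r : Rel σ) → Vec (Term n) (relArity σ r) → Formula X n
    not     : Formula X n → Formula X n
    and     : Formula X n → Formula X n → Formula X n
    or      : Formula X n → Formula X n → Formula X n
    implies : Formula X n → Formula X n → Formula X n
    all     : Formula X (suc n) → Formula X n
    exists  : Formula X (suc n) → Formula X n

private
  Pointwise-map : ∀ {A B C : Set} {_~_ : C → C → Set} (g : A → B) (h : B → C) (k : A → C) →
    (∀ x → h (g x) ~ k x) →
    ∀ {n} (xs : Vec A n) → Pointwise _~_ (map h (map g xs)) (map k xs)
  Pointwise-map g h k eq []       = []
  Pointwise-map g h k eq (x ∷ xs) = eq x ∷ Pointwise-map g h k eq xs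

  Pointwise-id : ∀ {A : Set} {_~_ : A → A → Set} → (∀ {x} → x ~ x) →
    ∀ {n} (xs : Vec A n) → Pointwise _~_ xs (map id xs)
  Pointwise-id rfl []       = []
  Pointwise-id rfl (x ∷ xs) = rfl ∷ Pointwise-id rfl xs

  Pointwise-back : ∀ {A B : Set} {_~_ : A → A → Set} (g : A → B) (h : B → A) →
    (∀ x → h (g x) ~ x) →
    ∀ {n} (xs : Vec A n) → Pointwise _~_ (map h (map g xs)) xs
  Pointwise-back g h eq []       = []
  Pointwise-back g h eq (x ∷ xs) = eq x ∷ Pointwise-back g h eq xs

module _ {σ : Signature} where

  open Structure

  record Isomorphism (M N : Structure σ) : Set where
    field
      bijection : Inverse (domain M) (domain N)
    open Inverse bijection public
    field
      fun-hom : ∀ f xs → _≈_ N (to (fun M f xs)) (fun N f (map to xs))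
      rel-hom : ∀ r xs → rel M r xs ⇔ rel N r (map to xs)

  open Isomorphism

  idIso : ∀ {M} → Isomorphism M M
  idIso {M} = record
    { bijection = Identity.inverse (domain M)
    ; fun-hom = λ f xs → fun-cong M f (Pointwise-id (refl M) xs)
    ; rel-hom = λ r xs → mk⇔
        (rel-cong M r (Pointwise-id (refl M) xs))
        (rel-cong M r (PW.sym (sym M) (Pointwise-id (refl M) xs)))
    }

  symIso : ∀ {M N} → Isomorphism M N → Isomorphism N M
  symIso {M} {N} i = record
    { bijection = Symmetry.inverse (bijection i)
    ; fun-hom = λ f xs → trans M
        (from-cong i (fun-cong N f (PW.sym (sym N) (back xs))))
        (trans M
          (from-cong i (sym N (fun-hom i f (map (from i) xs))))
          (strictlyInverseʳ i _))
    ; rel-hom = λ r xs → mk⇔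
        (Equivalence.from (rel-hom i r (map (from i) xs))
          ∘ rel-cong N r (PW.sym (sym N) (back xs)))
        (rel-cong N r (back xs)
          ∘ Equivalence.to (rel-hom i r (map (from i) xs)))
    }
    where
    back : ∀ {n} (xs : Vec (Carrier N) n) → Pointwise (_≈_ N) (map (to i) (map (from i) xs)) xs
    back = Pointwise-back (from i) (to i) (strictlyInverseˡ i)

  -- Diagrammatic order: first i, then j.
  transIso : ∀ {M N O} → Isomorphism M N → Isomorphism N O → Isomorphism M O
  transIso {M} {N} {O} i j = record
    { bijection = Compose.inverse (bijection i) (bijection j)
    ; fun-hom = λ f xs → trans O (to-cong j (fun-hom i f xs))
        (trans O (fun-hom j f (map (to i) xs)) (fun-cong O f (comp xs)))
    ; rel-hom = λ r xs → mk⇔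
        (rel-cong O r (comp xs)
          ∘ Equivalence.to (rel-hom j r (map (to i) xs))
          ∘ Equivalence.to (rel-hom i r xs))
        (Equivalence.from (rel-hom i r xs)
          ∘ Equivalence.from (rel-hom j r (map (to i) xs))
          ∘ rel-cong O r (PW.sym (sym O) (comp xs)))
    }
    where
    comp : ∀ {n} (xs : Vec (Carrier M) n) →
      Pointwise (_≈_ O) (map (to j) (map (to i) xs)) (map (to j ∘ to i) xs)
    comp = Pointwise-map (to i) (to j) (to j ∘ to i) (λ _ → refl O)

  Aut : Structure σ → Group 0ℓ 0ℓ
  Aut M = record
    { Carrier = Isomorphism M M
    ; _≈_     = λ a b → ∀ x → _≈_ M (to a x) (to b x)
    ; _∙_     = λ a b → transIso b a
    ; ε       = idIso
    ; _⁻¹     = symIso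
    ; isGroup = record
      { isMonoid = record
        { isSemigroup = record
          { isMagma = record
            { isEquivalence = record
              { refl  = λ _ → refl M
              ; sym   = λ p x → sym M (p x)
              ; trans = λ p q x → trans M (p x) (q x)
              }
            ; ∙-cong = λ {a} {b} {c} {d} p q x → trans M (to-cong a (q x)) (p (to d x))
            }
          ; assoc = λ _ _ _ _ → refl M
          }
        ; identity = (λ _ _ → refl M) , (λ _ _ → refl M)
        }
      ; inverse = (λ a → strictlyInverseʳ a) , (λ a → strictlyInverseˡ a)
      ; ⁻¹-cong = λ {a} {b} p x → trans M
          (from-cong a (trans M (sym M (strictlyInverseˡ b x)) (sym M (p (from b x)))))
          (strictlyInverseʳ a (from b x))
      }
    }

  ∣Aut_∣≤2^ℵ₀ : Structure σ → Set
  ∣Aut M ∣≤2^ℵ₀ = Group.setoid (Aut M) ≼ Continuum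

  ∣Aut∣≤2^ℵ₀-invariant : ∀ {M N} → Isomorphism M N → ∣Aut M ∣≤2^ℵ₀ → ∣Aut N ∣≤2^ℵ₀
  ∣Aut∣≤2^ℵ₀-invariant {M} {N} i = Compose.injection conjugation
    where
    conjugation : Group.setoid (Aut N) ≼ Group.setoid (Aut M)
    conjugation = record
      { to = λ a → transIso i (transIso a (symIso i))
      ; cong = λ p x → from-cong i (p (to i x))
      ; injective = λ {a} {b} p y →
          let step : _≈_ N (to a (to i (from i y))) (to b (to i (from i y)))
              step = trans N (sym N (strictlyInverseˡ i _))
                       (trans N (to-cong i (p (from i y))) (strictlyInverseˡ i _))
          in trans N (to-cong a (sym N (strictlyInverseˡ i y)))
               (trans N step (to-cong b (strictlyInverseˡ i y)))
      }

  module _ (M : Structure σ) {n : ℕ} (ρ : Vec (Carrier M) n) where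
    mutual
      eval : Term σ n → Carrier M
      eval (var x)    = lookup ρ x
      eval (app f ts) = fun M f (evals ts)

      evals : ∀ {k} → Vec (Term σ n) k → Vec (Carrier M) k
      evals []       = []
      evals (t ∷ ts) = eval t ∷ evals ts

  module _ {X : Set} (⟦_⟧ : X → Structure σ → Set) where

    Sat : (M : Structure σ) {n : ℕ} → Vec (Carrier M) n → Formula σ X n → Set
    Sat M ρ (extra x)     = ⟦ x ⟧ M
    Sat M ρ (equal s t)   = _≈_ M (eval M ρ s) (eval M ρ t)
    Sat M ρ (atom r ts)   = rel M r (evals M ρ ts)
    Sat M ρ (not φ)       = ¬ Sat M ρ φ
    Sat M ρ (and φ ψ)     = Sat M ρ φ × Sat M ρ ψ
    Sat M ρ (or φ ψ)      = Sat M ρ φ ⊎ Sat M ρ ψ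
    Sat M ρ (implies φ ψ) = Sat M ρ φ → Sat M ρ ψ
    Sat M ρ (all φ)       = (x : Carrier M) → Sat M (x ∷ ρ) φ
    Sat M ρ (exists φ)    = Σ (Carrier M) λ x → Sat M (x ∷ ρ) φ

  private
    module Transfer {M N : Structure σ} (i : Isomorphism M N) where

      _∼_ : Carrier M → Carrier N → Set
      x ∼ y = _≈_ N (to i x) y

      map-∼ : ∀ {n} {xs : Vec (Carrier M) n} {ys : Vec (Carrier N) n} →
        Pointwise _∼_ xs ys → Pointwise (_≈_ N) (map (to i) xs) ys
      map-∼ []       = []
      map-∼ (p ∷ ps) = p ∷ map-∼ ps

      module _ {n : ℕ} {ρ : Vec (Carrier M) n} {ρ′ : Vec (Carrier N) n} (e : Pointwise _∼_ ρ ρ′) where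
        mutual
          eval-∼ : ∀ t → eval M ρ t ∼ eval N ρ′ t
          eval-∼ (var x)    = PW.lookup e x
          eval-∼ (app f ts) = trans N (fun-hom i f _) (fun-cong N f (map-∼ (evals-∼ ts)))

          evals-∼ : ∀ {k} (ts : Vec (Term σ n) k) → Pointwise _∼_ (evals M ρ ts) (evals N ρ′ ts)
          evals-∼ []       = []
          evals-∼ (t ∷ ts) = eval-∼ t ∷ evals-∼ ts

      reflect : ∀ {x x′ y y′} → x ∼ y → x′ ∼ y′ → _≈_ N y y′ → _≈_ M x x′
      reflect {x} {x′} p q r = trans M (sym M (strictlyInverseʳ i x))
        (trans M (from-cong i (trans N p (trans N r (sym N q)))) (strictlyInverseʳ i x′))

      module _ {X : Set} (⟦_⟧ : X → Structure σ → Set) (inv : ∀ x → ⟦ x ⟧ M ⇔ ⟦ x ⟧ N) where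

        open Equivalence using () renaming (to to fwd; from to bwd)

        sat : ∀ {n} {ρ : Vec (Carrier M) n} {ρ′ : Vec (Carrier N) n} → Pointwise _∼_ ρ ρ′ →
          ∀ φ → Sat ⟦_⟧ M ρ φ ⇔ Sat ⟦_⟧ N ρ′ φ
        sat e (extra x)     = inv x
        sat e (equal s t)   = mk⇔
          (λ p → trans N (sym N (eval-∼ e s)) (trans N (to-cong i p) (eval-∼ e t)))
          (reflect (eval-∼ e s) (eval-∼ e t))
        sat e (atom r ts)   = mk⇔
          (rel-cong N r (map-∼ (evals-∼ e ts)) ∘ fwd (rel-hom i r _))
          (bwd (rel-hom i r _) ∘ rel-cong N r (PW.sym (sym N) (map-∼ (evals-∼ e ts))))
        sat e (not φ)       = mk⇔ (_∘ bwd (sat e φ)) (_∘ fwd (sat e φ))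
        sat e (and φ ψ)     = mk⇔
          (Product.map (fwd (sat e φ)) (fwd (sat e ψ)))
          (Product.map (bwd (sat e φ)) (bwd (sat e ψ)))
        sat e (or φ ψ)      = mk⇔
          (Sum.map (fwd (sat e φ)) (fwd (sat e ψ)))
          (Sum.map (bwd (sat e φ)) (bwd (sat e ψ)))
        sat e (implies φ ψ) = mk⇔
          (λ h → fwd (sat e ψ) ∘ h ∘ bwd (sat e φ))
          (λ h → bwd (sat e ψ) ∘ h ∘ fwd (sat e φ))
        sat e (all φ)       = mk⇔
          (λ h y → fwd (sat (strictlyInverseˡ i y ∷ e) φ) (h (from i y)))
          (λ h x → bwd (sat (refl N ∷ e) φ) (h (to i x)))
        sat e (exists φ)    = mk⇔
          (λ (x , h) → to i x , fwd (sat (refl N ∷ e) φ) h)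
          (λ (y , h) → from i y , bwd (sat (strictlyInverseˡ i y ∷ e) φ) h)

  Sat-invariant : ∀ {X} (⟦_⟧ : X → Structure σ → Set) →
    (∀ x {M N} → Isomorphism M N → ⟦ x ⟧ M → ⟦ x ⟧ N) →
    ∀ {M N} → Isomorphism M N → (φ : Formula σ X 0) → Sat ⟦_⟧ M [] φ → Sat ⟦_⟧ N [] φ
  Sat-invariant ⟦_⟧ inv i φ =
    Equivalence.to (Transfer.sat i ⟦_⟧ (λ x → mk⇔ (inv x i) (inv x (symIso i))) [] φ)

record AbstractLogic (σ : Signature) : Set₁ where
  infix 4 _⊨_
  field
    Sentence : Set
    _⊨_ : Structure σ → Sentence → Set
    ⊨-invariant : ∀ {M N} → Isomorphism M N → ∀ φ → M ⊨ φ → N ⊨ φ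

module _ {σ : Signature} where

  open AbstractLogic

  -- Every expressible class is equivalent to one of the form M ↦ M ⊨ φ, so
  -- nothing is lost by considering only classes at level 0ℓ.
  Expressible : AbstractLogic σ → Pred (Structure σ) 0ℓ → Set₁
  Expressible L K = ∃[ φ ] ∀ M → M ∈ K ⇔ _⊨_ L M φ

  infix 4 _≥_ _>_

  _≥_ : AbstractLogic σ → AbstractLogic σ → Set₁
  L ≥ L′ = ∀ K → Expressible L′ K → Expressible L K

  _>_ : AbstractLogic σ → AbstractLogic σ → Set₁
  L > L′ = L ≥ L′ × ∃[ K ] (Expressible L K × ¬ Expressible L′ K)

  CountableSubset : {A : Set} → Pred A 0ℓ → Set
  CountableSubset {A} Φ =
    Σ (A → ℕ) λ code → ∀ {φ ψ} → φ ∈ Φ → ψ ∈ Φ → code φ ≡ code ψ → φ ≡ ψ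

  HasModel : (L : AbstractLogic σ) → Pred (Sentence L) 0ℓ → Set₁
  HasModel L Φ = Σ (Structure σ) λ M → ∀ φ → φ ∈ Φ → _⊨_ L M φ

  -- The lists of elements of Φ enumerate its finite subsets.
  ℵ₀-Compact : AbstractLogic σ → Set₁
  ℵ₀-Compact L = ∀ Φ → CountableSubset Φ →
    (∀ (φs : List (Sentence L)) → All (_∈ Φ) φs → Σ (Structure σ) λ M → All (_⊨_ L M) φs) →
    HasModel L Φ

⟦_⟧⁰ : ∀ {σ} → ⊥ → Structure σ → Set
⟦ () ⟧⁰

FO : (σ : Signature) → AbstractLogic σ
FO σ = record
  { Sentence    = Formula σ ⊥ 0
  ; _⊨_         = λ M φ → Sat ⟦_⟧⁰ M [] φ
  ; ⊨-invariant = Sat-invariant ⟦_⟧⁰ λ ()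
  }

data AutAtom : Set where
  P : AutAtom

⟦_⟧ᴬ : ∀ {σ} → AutAtom → Structure σ → Set
⟦ P ⟧ᴬ M = ∣Aut M ∣≤2^ℵ₀

L : (σ : Signature) → AbstractLogic σ
L σ = record
  { Sentence    = Formula σ AutAtom 0
  ; _⊨_         = λ M φ → Sat ⟦_⟧ᴬ M [] φ
  ; ⊨-invariant = Sat-invariant ⟦_⟧ᴬ λ where P → ∣Aut∣≤2^ℵ₀-invariant
  }

-- Either every finite part of Φ has a model with at most 2^ℵ₀ automorphisms,
-- or every finite part has a model with more.  In both cases let Mᵢ be such
-- models of longer and longer parts, and let sᵢ be a sequence in Mᵢ.  Ramsey's
-- theorem for Skolem terms, applied in each Mᵢ, and a cluster point over i give
-- a complete template of indiscernibles, and for every linear order I the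
-- Skolem terms over I form a model N of Φ, the truth of φ(t₁, …, tₙ) in N
-- being its truth in Mᵢ along almost all increasing maps of I into sᵢ.  For
-- countable I the model is countable, so it has at most 2^ℵ₀ automorphisms.
-- If the Mᵢ have more than 2^ℵ₀ automorphisms they are infinite, so the sᵢ can
-- be taken injective, and then every automorphism of I acts faithfully on N;
-- the order I = 2^ℕ × ℤ has more than 2^ℵ₀ of them.  The latter construction
-- with all Mᵢ equal to one countable infinite structure M also gives N with
-- the first-order theory of M, so that P is not first-order expressible.

module Submission where

open import Defs
open import Axiom.ExcludedMiddle using (ExcludedMiddle)
open import Data.Bool.Base using (Bool; true; false; if_then_else_)
open import Data.Empty using (⊥; ⊥-elim)
open import Data.Fin.Base using (Fin; zero; suc; toℕ)
open import Data.Fin.Properties using (toℕ-injective)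
open import Data.Integer.Base as ℤ using (ℤ)
open import Data.Integer.Properties as ℤ using ()
open import Data.List.Base using (List; []; _∷_; _++_; length; map)
open import Data.List.Membership.Propositional using (_∈_; find)
open import Data.List.Membership.Propositional.Properties using (∈-++⁺ˡ; ∈-++⁺ʳ; ∈-map⁺)
open import Data.List.Relation.Unary.All as All using (All; []; _∷_)
open import Data.List.Relation.Unary.All.Properties as All using ()
open import Data.List.Properties using (length-map; map-∘)
open import Data.List.Relation.Unary.Any as Any using (Any; here; there)
open import Data.List.Relation.Unary.AllPairs as AllPairs using (AllPairs; []; _∷_)
open import Data.List.Relation.Unary.AllPairs.Properties as AllPairs using ()
open import Data.Maybe.Base as Maybe using (Maybe; just; nothing; fromMaybe; zipWith; _>>=_)
open import Data.Maybe.Properties using (just-injective)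
open import Data.Nat.Base using (ℕ; zero; suc; _≤_; _<_; _+_; _⊔_; z≤n; s≤s)
open import Data.Nat.Properties
open import Data.Product.Base as Product using (Σ; _×_; _,_; proj₁; proj₂)
open import Data.Product.Relation.Binary.Lex.Strict using (×-strictTotalOrder)
open import Data.Product.Properties using (,-injective)
open import Data.Sum.Base as Sum using (_⊎_; inj₁; inj₂; [_,_]′)
open import Data.Unit.Base using (⊤; tt)
open import Data.Vec.Base as Vec using (Vec; []; _∷_; lookup)
open import Data.Vec.Relation.Binary.Pointwise.Inductive using (Pointwise; []; _∷_)
open import Function.Base using (_∘_; id)
open import Function.Bundles using (Injection; Equivalence; _⇔_; mk⇔; mk↣)
open import Level using (0ℓ)
open import Relation.Binary.Bundles using (Setoid; StrictTotalOrder)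
open import Relation.Binary.Definitions using (Trichotomous; tri<; tri≈; tri>)
open import Relation.Binary.PropositionalEquality
open import Relation.Binary.Structures.Biased using (isStrictTotalOrderᶜ)
open import Relation.Nullary.Decidable using (yes; no; does; decidable-stable; does-⇔; dec-true)
open import Relation.Nullary.Negation.Core using (¬_; contradiction)
open import Relation.Unary using (Pred; _⊆_)

-- wit φ ts is a Skolem term for a witness of ∃x φ(x, ts), where φ itself
-- contains no Skolem terms.
data SkolemTerm (σ : Signature) (V : Set) : Set where
  gen : V → SkolemTerm σ V
  app : (f : Fun σ) → Vec (SkolemTerm σ V) (funArity σ f) → SkolemTerm σ V
  wit : ∀ {n} → Formula σ AutAtom (suc n) → Vec (SkolemTerm σ V) n → SkolemTerm σ V

-- The formula φ(ts), whose generators are to be interpreted by an increasing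
-- list of length arity.
record Query (σ : Signature) : Set where
  constructor query
  field
    arity     : ℕ
    {size}    : ℕ
    formula   : Formula σ AutAtom size
    arguments : Vec (SkolemTerm σ ℕ) size

-- Renaming and generators of Skolem terms

module _ {σ : Signature} where

  mutual
    rename : ∀ {V W} → (V → W) → SkolemTerm σ V → SkolemTerm σ W
    rename f (gen v)    = gen (f v)
    rename f (app g ts) = app g (renames f ts)
    rename f (wit φ ts) = wit φ (renames f ts)

    renames : ∀ {V W n} → (V → W) → Vec (SkolemTerm σ V) n → Vec (SkolemTerm σ W) n
    renames f []       = []
    renames f (t ∷ ts) = rename f t ∷ renames f ts

  renames≡map : ∀ {V W n} (f : V → W) (ts : Vec (SkolemTerm σ V) n) → renames f ts ≡ Vec.map (rename f) ts
  renames≡map f []       = refl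
  renames≡map f (t ∷ ts) = cong (rename f t ∷_) (renames≡map f ts)

  module _ {V W : Set} {f : V → W} {g : W → V} (inverse : ∀ v → g (f v) ≡ v) where

    mutual
      rename-inverse : ∀ t → rename g (rename f t) ≡ t
      rename-inverse (gen v)    = cong gen (inverse v)
      rename-inverse (app h ts) = cong (app h) (renames-inverse ts)
      rename-inverse (wit φ ts) = cong (wit φ) (renames-inverse ts)

      renames-inverse : ∀ {n} (ts : Vec (SkolemTerm σ V) n) → renames g (renames f ts) ≡ ts
      renames-inverse []       = refl
      renames-inverse (t ∷ ts) = cong₂ _∷_ (rename-inverse t) (renames-inverse ts)

  mutual
    generators : ∀ {V} → SkolemTerm σ V → List V
    generators (gen v)    = v ∷ []
    generators (app f ts) = generatorss ts
    generators (wit φ ts) = generatorss ts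

    generatorss : ∀ {V n} → Vec (SkolemTerm σ V) n → List V
    generatorss []       = []
    generatorss (t ∷ ts) = generators t ++ generatorss ts

nth : List ℕ → ℕ → ℕ
-- An enumerated query may mention indices beyond its arity, so a default value is needed.
nth []       n       = 0
nth (x ∷ xs) zero    = x
nth (x ∷ xs) (suc n) = nth xs n

-- Sorted finite lists in a linear order

module Order (O : StrictTotalOrder 0ℓ 0ℓ 0ℓ) where

  open StrictTotalOrder O using (compare) renaming (_≟_ to _≟ᴵ_; Carrier to I; _≈_ to _≋_; _<_ to _≺_)
  private module O = StrictTotalOrder O

  -- Monotonicity is asked on a finite set only, since a dense or uncountable order has no
  -- increasing map into ℕ.
  Embeds : List I → (I → ℕ) → Set
  Embeds F g = ∀ {x y} → x ∈ F → y ∈ F → (x ≺ y → g x < g y) × (x ≋ y → g x ≡ g y)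

  embeds-sorted : ∀ {F g xs} → Embeds F g → All (_∈ F) xs → AllPairs _≺_ xs → AllPairs _<_ (map g xs)
  embeds-sorted e []       []              = []
  embeds-sorted e (p ∷ ps) (below ∷ sorted) =
    All.map⁺ (All.zipWith (λ (lt , q) → proj₁ (e p q) lt) (below , ps)) ∷ embeds-sorted e ps sorted

  insert : I → List I → List I
  insert x []      = x ∷ []
  insert x (y ∷ u) with compare x y
  ... | tri< _ _ _ = x ∷ y ∷ u
  ... | tri≈ _ _ _ = y ∷ u
  ... | tri> _ _ _ = y ∷ insert x u

  All-insert : ∀ {Q : Pred I 0ℓ} {x u} → Q x → All Q u → All Q (insert x u)
  All-insert q []       = q ∷ []
  All-insert {x = x} {y ∷ u} q (q′ ∷ qs) with compare x y
  ... | tri< _ _ _ = q ∷ q′ ∷ qs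
  ... | tri≈ _ _ _ = q′ ∷ qs
  ... | tri> _ _ _ = q′ ∷ All-insert q qs

  insert-sorted : ∀ x {u} → AllPairs _≺_ u → AllPairs _≺_ (insert x u)
  insert-sorted x [] = [] ∷ []
  insert-sorted x {y ∷ u} (below ∷ sorted) with compare x y
  ... | tri< x≺y _ _ = (x≺y ∷ All.map (O.trans x≺y) below) ∷ below ∷ sorted
  ... | tri≈ _ _ _   = below ∷ sorted
  ... | tri> _ _ y≺x = All-insert y≺x below ∷ insert-sorted x sorted

  -- Membership holds only up to `_≋_`: an element equivalent to an entry is dropped, and that entry
  -- represents it.
  ∈-insert : ∀ x u → Any (x ≋_) (insert x u)
  ∈-insert x [] = here O.Eq.refl
  ∈-insert x (y ∷ u) with compare x y
  ... | tri< _ _ _   = here O.Eq.refl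
  ... | tri≈ _ x≋y _ = here x≋y
  ... | tri> _ _ _   = there (∈-insert x u)

  insert-⊇ : ∀ {Q : Pred I 0ℓ} x {u} → Any Q u → Any Q (insert x u)
  insert-⊇ x {y ∷ u} any with compare x y | any
  ... | tri< _ _ _ | any       = there any
  ... | tri≈ _ _ _ | any       = any
  ... | tri> _ _ _ | here q    = here q
  ... | tri> _ _ _ | there any = there (insert-⊇ x any)

  sort : List I → List I
  sort []      = []
  sort (x ∷ F) = insert x (sort F)

  sort-sorted : ∀ F → AllPairs _≺_ (sort F)
  sort-sorted []      = []
  sort-sorted (x ∷ F) = insert-sorted x (sort-sorted F)

  sort-⊆ : ∀ F → All (_∈ F) (sort F)
  sort-⊆ []      = []
  sort-⊆ (x ∷ F) = All-insert (here refl) (All.map there (sort-⊆ F))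

  sort-⊇ : ∀ {F x} → x ∈ F → Any (x ≋_) (sort F)
  sort-⊇ {y ∷ F} (here refl) = ∈-insert y (sort F)
  sort-⊇ {y ∷ F} (there x∈F) = insert-⊇ y (sort-⊇ x∈F)

  position : I → List I → ℕ
  position x []      = 0
  position x (y ∷ u) with x ≟ᴵ y
  ... | yes _ = 0
  ... | no _  = suc (position x u)

  position-cong : ∀ {x y} u → x ≋ y → position x u ≡ position y u
  position-cong [] x≋y = refl
  position-cong {x} {y} (z ∷ u) x≋y with x ≟ᴵ z | y ≟ᴵ z
  ... | yes _   | yes _   = refl
  ... | no _    | no _    = cong suc (position-cong u x≋y)
  ... | yes x≋z | no y≉z  = contradiction (O.Eq.trans (O.Eq.sym x≋y) x≋z) y≉z
  ... | no x≉z  | yes y≋z = contradiction (O.Eq.trans x≋y y≋z) x≉z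

  position-mono : ∀ {x y u} → AllPairs _≺_ u → Any (x ≋_) u → Any (y ≋_) u →
    x ≺ y → position x u < position y u
  position-mono {x} {y} {z ∷ u} (below ∷ sorted) x∈ y∈ x≺y with x ≟ᴵ z | y ≟ᴵ z | x∈ | y∈
  ... | yes x≋z | yes y≋z | _         | _         = contradiction x≺y (O.irrefl (O.Eq.trans x≋z (O.Eq.sym y≋z)))
  ... | yes _   | no _    | _         | _         = s≤s z≤n
  ... | no x≉z  | _       | here x≋z  | _         = contradiction x≋z x≉z
  ... | no _    | no y≉z  | there _   | here y≋z  = contradiction y≋z y≉z
  ... | no _    | no _    | there x∈u | there y∈u = s≤s (position-mono sorted x∈u y∈u x≺y)
  ... | no _    | yes y≋z | there x∈u | _
    -- Here y is equivalent to the head z while x occurs in the tail, so z ≺ x, against x ≺ y.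
    with w , w∈u , x≋w ← find x∈u
    = contradiction (O.<-respʳ-≈ y≋z x≺y)
        (O.asym (O.<-respʳ-≈ (O.Eq.sym x≋w) (All.lookup below w∈u)))

  -- This undoes the replacement of generators by positions in `decide`. Compatibility of g with
  -- `_≋_` enters because u may contain only a representative of x.
  nth-position : ∀ {x u} {g : I → ℕ} → Any (x ≋_) u → (∀ {y} → y ∈ u → x ≋ y → g x ≡ g y) →
    nth (map g u) (position x u) ≡ g x
  nth-position {x} {y ∷ u} any g-cong with x ≟ᴵ y | any
  ... | yes x≋y | _         = sym (g-cong (here refl) x≋y)
  ... | no x≉y  | here x≋y  = contradiction x≋y x≉y
  ... | no _    | there any = nth-position any (λ y∈u → g-cong (there y∈u))

-- Consequences of excluded middle

module Classical (em : ∀ {ℓ} → ExcludedMiddle ℓ) where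

  by-contradiction : ∀ {ℓ} {A : Set ℓ} → ¬ ¬ A → A
  by-contradiction = decidable-stable em

  ⌊_⌋ : ∀ {ℓ} → Set ℓ → Bool
  ⌊ A ⌋ = does (em {P = A})

  ⌊⌋-true⁻ : ∀ {ℓ} {A : Set ℓ} → ⌊ A ⌋ ≡ true → A
  ⌊⌋-true⁻ {A = A} eq with yes a ← em {P = A} = a

  ⌊⌋-false⁻ : ∀ {ℓ} {A : Set ℓ} → ⌊ A ⌋ ≡ false → ¬ A
  ⌊⌋-false⁻ {A = A} eq with no ¬a ← em {P = A} = ¬a

  ⌊⌋-cong : ∀ {ℓ} {A B : Set ℓ} → (A → B) → (B → A) → ⌊ A ⌋ ≡ ⌊ B ⌋
  ⌊⌋-cong f g = does-⇔ (mk⇔ f g) em em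

  -- Ramsey's theorem

  Unbounded : Pred ℕ 0ℓ → Set
  Unbounded A = ∀ n → Σ ℕ λ x → n ≤ x × A x

  -- Subsets of size m are represented by their increasing enumerations.
  Homogeneous : ℕ → (List ℕ → Bool) → Pred ℕ 0ℓ → Bool → Set
  Homogeneous m c A b = ∀ xs → AllPairs _<_ xs → All A xs → length xs ≡ m → c xs ≡ b

  pigeonhole : ∀ (b : ℕ → Bool) → Σ Bool λ v → Unbounded (λ x → b x ≡ v)
  pigeonhole b with em {P = Unbounded (λ x → b x ≡ true)}
  ... | yes often = true , often
  -- If `false` did not occur from n on, every n ⊔ m would be coloured `true`, and `true` would
  -- occur unboundedly.
  ... | no ¬often = false , λ n → by-contradiction λ none → ¬often λ m → n ⊔ m , m≤n⊔m n m , always n m none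
    where
    always : ∀ n m → ¬ (Σ ℕ λ x → n ≤ x × b x ≡ false) → b (n ⊔ m) ≡ true
    always n m none with b (n ⊔ m) in eq
    ... | true  = refl
    ... | false = ⊥-elim (none (n ⊔ m , m≤m⊔n n m , eq))

  unbounded-above : ∀ {A} → Unbounded A → ∀ x → Unbounded (λ y → A y × x < y)
  unbounded-above u x n with y , le , Ay ← u (suc x ⊔ n) =
    y , ≤-trans (m≤n⊔m (suc x) n) le , Ay , ≤-trans (m≤m⊔n (suc x) n) le

  -- Induction on m. Take an element a k of the current set S k and shrink the part above it to a
  -- set homogeneous for the colouring c (a k ∷ _) of m-subsets. Along the resulting sequence the
  -- colour of an (m+1)-subset depends only on its least element, and the pigeonhole principle makes
  -- that colour constant.
  ramsey : ∀ m (c : List ℕ → Bool) (A : Pred ℕ 0ℓ) → Unbounded A →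
    Σ (Pred ℕ 0ℓ) λ B → Σ Bool λ b → Unbounded B × B ⊆ A × Homogeneous m c B b
  ramsey zero c A u = A , c [] , u , (λ Ax → Ax) , λ where
    []       _ _ _  → refl
    (_ ∷ _) _ _ ()
  ramsey (suc m) c A u = B , v , B-unbounded , B⊆A , homogeneous
    where
    State : Set₁
    State = Σ (Pred ℕ 0ℓ) Unbounded

    element : State → ℕ
    element (_ , u) = proj₁ (u 0)

    next : (s : State) → Σ (Pred ℕ 0ℓ) λ B → Σ Bool λ b →
      Unbounded B × B ⊆ (λ y → proj₁ s y × element s < y) ×
      Homogeneous m (λ xs → c (element s ∷ xs)) B b
    next s = ramsey m (λ xs → c (element s ∷ xs)) _ (unbounded-above (proj₂ s) (element s))

    state : ℕ → State
    state zero    = A , u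
    state (suc k) = let B , _ , uB , _ = next (state k) in B , uB

    S : ℕ → Pred ℕ 0ℓ
    S k = proj₁ (state k)

    a : ℕ → ℕ
    a k = element (state k)

    colour : ℕ → Bool
    colour k = proj₁ (proj₂ (next (state k)))

    a∈S : ∀ k → S k (a k)
    a∈S k = proj₂ (proj₂ (proj₂ (state k) 0))

    S-suc : ∀ k {x} → S (suc k) x → S k x × a k < x
    S-suc k = proj₁ (proj₂ (proj₂ (proj₂ (next (state k)))))

    S-antitone : ∀ {k j x} → k ≤ j → S j x → S k x
    S-antitone {k} {j} {x} k≤j with d , refl ← m≤n⇒∃[o]m+o≡n k≤j = go d
      where
      go : ∀ d → S (k + d) x → S k x
      go zero    s = subst (λ j → S j x) (+-identityʳ k) s
      go (suc d) s = go d (proj₁ (S-suc (k + d) (subst (λ j → S j x) (+-suc k d) s)))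

    a-mono : ∀ {k j} → k < j → a k < a j
    a-mono {k} {j} k<j = proj₂ (S-suc k (S-antitone k<j (a∈S j)))

    a-cancel : ∀ {k j} → a k < a j → k < j
    a-cancel {k} {j} lt with <-cmp k j
    ... | tri< k<j _ _ = k<j
    ... | tri≈ _ refl _ = ⊥-elim (<-irrefl refl lt)
    ... | tri> _ _ j<k = ⊥-elim (<-asym lt (a-mono j<k))

    k≤a : ∀ k → k ≤ a k
    k≤a zero    = z≤n
    k≤a (suc k) = ≤-trans (s≤s (k≤a k)) (a-mono (n<1+n k))

    v : Bool
    v = proj₁ (pigeonhole colour)

    B : Pred ℕ 0ℓ
    B x = Σ ℕ λ k → a k ≡ x × colour k ≡ v

    B-unbounded : Unbounded B
    B-unbounded n with k , n≤k , eq ← proj₂ (pigeonhole colour) n =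
      a k , ≤-trans n≤k (k≤a k) , k , refl , eq

    B⊆A : B ⊆ A
    B⊆A (k , refl , _) = S-antitone {j = k} z≤n (a∈S k)

    homogeneous : Homogeneous (suc m) c B v
    homogeneous (_ ∷ xs) (lt ∷ sorted) ((k , refl , ck) ∷ bs) len =
      -- The entries after a k are of the form a j with k < j, so they lie in S (suc k).
      trans (proj₂ (proj₂ (proj₂ (proj₂ (next (state k))))) xs sorted
              (All.zipWith (λ where (l , j , refl , _) → S-antitone {suc k} {j} (a-cancel l) (a∈S j)) (lt , bs))
              (suc-injective len))
            ck

  -- Applying `ramsey` to one colouring after another gives a decreasing chain of unbounded sets,
  -- and subsets inherit homogeneity. There need not be one set for all colourings, but the colours
  -- b do not depend on the stage K.
  iterated-ramsey : ∀ (m : ℕ → ℕ) (c : ℕ → List ℕ → Bool) →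
    Σ (ℕ → Bool) λ b → ∀ K → Σ (Pred ℕ 0ℓ) λ A →
      Unbounded A × ∀ {k} → k < K → Homogeneous (m k) (c k) A (b k)
  iterated-ramsey m c = b , λ K → proj₁ (state K) , proj₂ (state K) , homogeneous K
    where
    mutual
      state : ℕ → Σ (Pred ℕ 0ℓ) Unbounded
      state zero    = (λ _ → ⊤) , λ n → n , ≤-refl , tt
      state (suc k) = let B , _ , uB , _ = next k in B , uB

      next : ∀ k → Σ (Pred ℕ 0ℓ) λ B → Σ Bool λ b →
        Unbounded B × B ⊆ proj₁ (state k) × Homogeneous (m k) (c k) B b
      next k = ramsey (m k) (c k) (proj₁ (state k)) (proj₂ (state k))

    b : ℕ → Bool
    b k = proj₁ (proj₂ (next k))

    homogeneous : ∀ K {k} → k < K → Homogeneous (m k) (c k) (proj₁ (state K)) (b k)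
    homogeneous (suc K) {k} k<1+K xs sorted al len with k ≟ K
    ... | yes refl = proj₂ (proj₂ (proj₂ (proj₂ (next K)))) xs sorted al len
    ... | no k≢K = homogeneous K (≤∧≢⇒< (≤-pred k<1+K) k≢K) xs sorted
                     (All.map (proj₁ (proj₂ (proj₂ (proj₂ (next K))))) al) len

  -- The colour sequences of the individual colourings have a cluster point,
  -- by Ramsey's theorem for singletons.
  homogeneous-cluster : ∀ (m : ℕ → ℕ) (c : ℕ → ℕ → List ℕ → Bool) →
    Σ (ℕ → Bool) λ T → ∀ K → Σ ℕ λ i → K ≤ i × Σ (Pred ℕ 0ℓ) λ A →
      Unbounded A × ∀ {k} → k < K → Homogeneous (m k) (c i k) A (T k)
  homogeneous-cluster m c = proj₁ cluster , λ K →
    let indices , unbounded , agree = proj₂ cluster K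
        i , K≤i , i∈ = unbounded K
        A , uA , homogeneous = proj₂ (single i) K
    in i , K≤i , A , uA , λ {k} k<K →
      subst (Homogeneous (m k) (c i k) A)
        (agree k<K (i ∷ []) ([] ∷ []) (i∈ ∷ []) refl) (homogeneous k<K)
    where
    single : ∀ i → _
    single i = iterated-ramsey m (c i)

    colour : ℕ → List ℕ → Bool
    colour k []      = false
    colour k (i ∷ _) = proj₁ (single i) k

    cluster : _
    cluster = iterated-ramsey (λ _ → 1) colour

  -- Countability of the syntax

  module _ {A : Set} (countable : Countable A) where

    open Injection countable using () renaming (to to code; injective to code-injective)

    decode : ℕ → Maybe A
    decode n with em {P = Σ A λ a → code a ≡ n}
    ... | yes (a , _) = just a
    ... | no _        = nothing

    decode-code : ∀ a → decode (code a) ≡ just a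
    decode-code a with em {P = Σ A λ b → code b ≡ code a}
    ... | yes (b , eq) = cong just (code-injective eq)
    ... | no none      = ⊥-elim (none (a , refl))

    enumeration : A → Σ (ℕ → A) λ e → ∀ a → Σ ℕ λ n → e n ≡ a
    enumeration default = (λ n → fromMaybe default (decode n)) ,
      λ a → code a , cong (fromMaybe default) (decode-code a)

  -- The successor in Cantor's enumeration along antidiagonals: from the end (0 , y) of one it jumps
  -- to the start of the next.
  zigzag : ℕ × ℕ → ℕ × ℕ
  zigzag (zero  , y) = suc y , zero
  zigzag (suc x , y) = x , suc y

  unpair : ℕ → ℕ × ℕ
  unpair zero    = zero , zero
  unpair (suc n) = zigzag (unpair n)

  unpair-surjective : ∀ x y → Σ ℕ λ n → unpair n ≡ (x , y)
  unpair-surjective x y = along y x (axis (x + y))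
    where
    along : ∀ y x → (Σ ℕ λ n → unpair n ≡ (x + y , 0)) → Σ ℕ λ n → unpair n ≡ (x , y)
    along zero    x r = subst (λ z → Σ ℕ λ n → unpair n ≡ (z , 0)) (+-identityʳ x) r
    along (suc y) x r
      with n , eq ← along y (suc x) (subst (λ z → Σ ℕ λ n → unpair n ≡ (z , 0)) (+-suc x y) r)
      = suc n , cong zigzag eq

    axis : ∀ d → Σ ℕ λ n → unpair n ≡ (d , 0)
    axis zero    = 0 , refl
    axis (suc d) with n , eq ← along d 0 (axis d) = suc n , cong zigzag eq

  abstract
    pair : ℕ → ℕ → ℕ
    pair x y = proj₁ (unpair-surjective x y)

    unpair-pair : ∀ x y → unpair (pair x y) ≡ (x , y)
    unpair-pair x y = proj₂ (unpair-surjective x y)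

  pair-injective : ∀ {x y x′ y′} → pair x y ≡ pair x′ y′ → x ≡ x′ × y ≡ y′
  pair-injective {x} {y} {x′} {y′} eq =
    ,-injective (trans (sym (unpair-pair x y)) (trans (cong unpair eq) (unpair-pair x′ y′)))

  -- A common target for coding all the syntax, so that only one injection into ℕ is built by hand.
  -- For each kind of syntax a partial decoder that inverts the encoder then suffices, with no
  -- comparison of pairs of constructors.
  data Tree : Set where
    leaf : ℕ → Tree
    node : Tree → Tree → Tree

  Tree-countable : Countable Tree
  Tree-countable = mk↣ {to = code} (injective _ _)
    where
    code : Tree → ℕ
    code (leaf n)   = pair 0 n
    code (node s t) = pair 1 (pair (code s) (code t))

    injective : ∀ s t → code s ≡ code t → s ≡ t
    injective (leaf m) (leaf n) eq = cong leaf (proj₂ (pair-injective eq))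
    injective (leaf m) (node s t) eq with () ← proj₁ (pair-injective eq)
    injective (node s t) (leaf n) eq with () ← proj₁ (pair-injective eq)
    injective (node s t) (node s′ t′) eq
      with p , q ← pair-injective (proj₂ (pair-injective eq))
      = cong₂ node (injective s s′ p) (injective t t′ q)

  tree-coded : ∀ {A : Set} (encode : A → Tree) (decode : Tree → Maybe A) →
    (∀ a → decode (encode a) ≡ just a) → Countable A
  tree-coded encode decode retract = mk↣ {to = λ a → Injection.to Tree-countable (encode a)} λ {a} {b} eq →
    just-injective (trans (sym (retract a))
      (trans (cong decode (Injection.injective Tree-countable eq)) (retract b)))

  Fin-countable : ∀ n → Countable (Fin n)
  Fin-countable n = mk↣ {to = toℕ} toℕ-injective

  module _ {σ : Signature} (countableσ : CountableSignature σ) where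

    funs : Countable (Fun σ)
    funs = proj₁ countableσ

    rels : Countable (Rel σ)
    rels = proj₂ countableσ

    funCode : Fun σ → ℕ
    funCode = Injection.to funs

    relCode : Rel σ → ℕ
    relCode = Injection.to rels

    mutual
      encodeTerm : ∀ {n} → Term σ n → Tree
      encodeTerm (var x)    = node (leaf 0) (leaf (toℕ x))
      encodeTerm (app f ts) = node (leaf 1) (node (leaf (funCode f)) (encodeTerms ts))

      encodeTerms : ∀ {n k} → Vec (Term σ n) k → Tree
      encodeTerms []       = leaf 0
      encodeTerms (t ∷ ts) = node (encodeTerm t) (encodeTerms ts)

    mutual
      decodeTerm : ∀ n → Tree → Maybe (Term σ n)
      decodeTerm n (node (leaf 0) (leaf k)) = Maybe.map var (decode (Fin-countable n) k)
      decodeTerm n (node (leaf 1) (node (leaf k) t)) =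
        decode funs k >>= λ f → Maybe.map (app f) (decodeTerms n (funArity σ f) t)
      decodeTerm n _ = nothing

      decodeTerms : ∀ n k → Tree → Maybe (Vec (Term σ n) k)
      decodeTerms n zero    _          = just []
      decodeTerms n (suc k) (node s t) = zipWith _∷_ (decodeTerm n s) (decodeTerms n k t)
      decodeTerms n (suc k) (leaf _)   = nothing

    mutual
      decode-encodeTerm : ∀ {n} (t : Term σ n) → decodeTerm n (encodeTerm t) ≡ just t
      decode-encodeTerm {n} (var x) rewrite decode-code (Fin-countable n) x = refl
      decode-encodeTerm (app f ts) rewrite decode-code funs f | decode-encodeTerms ts = refl

      decode-encodeTerms : ∀ {n k} (ts : Vec (Term σ n) k) → decodeTerms n k (encodeTerms ts) ≡ just ts
      decode-encodeTerms []       = refl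
      decode-encodeTerms (t ∷ ts) rewrite decode-encodeTerm t | decode-encodeTerms ts = refl

    encodeFormula : ∀ {n} → Formula σ AutAtom n → Tree
    encodeFormula (extra P)     = leaf 0
    encodeFormula (equal s t)   = node (leaf 0) (node (encodeTerm s) (encodeTerm t))
    encodeFormula (atom r ts)   = node (leaf 1) (node (leaf (relCode r)) (encodeTerms ts))
    encodeFormula (not φ)       = node (leaf 2) (encodeFormula φ)
    encodeFormula (and φ ψ)     = node (leaf 3) (node (encodeFormula φ) (encodeFormula ψ))
    encodeFormula (or φ ψ)      = node (leaf 4) (node (encodeFormula φ) (encodeFormula ψ))
    encodeFormula (implies φ ψ) = node (leaf 5) (node (encodeFormula φ) (encodeFormula ψ))
    encodeFormula (all φ)       = node (leaf 6) (encodeFormula φ)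
    encodeFormula (exists φ)    = node (leaf 7) (encodeFormula φ)

    decodeFormula : ∀ n → Tree → Maybe (Formula σ AutAtom n)
    decodeFormula n (leaf _) = just (extra P)
    decodeFormula n (node (leaf 0) (node s t)) = zipWith equal (decodeTerm n s) (decodeTerm n t)
    decodeFormula n (node (leaf 1) (node (leaf k) t)) =
      decode rels k >>= λ r → Maybe.map (atom r) (decodeTerms n (relArity σ r) t)
    decodeFormula n (node (leaf 2) t) = Maybe.map not (decodeFormula n t)
    decodeFormula n (node (leaf 3) (node s t)) = zipWith and (decodeFormula n s) (decodeFormula n t)
    decodeFormula n (node (leaf 4) (node s t)) = zipWith or (decodeFormula n s) (decodeFormula n t)
    decodeFormula n (node (leaf 5) (node s t)) = zipWith implies (decodeFormula n s) (decodeFormula n t)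
    decodeFormula n (node (leaf 6) t) = Maybe.map all (decodeFormula (suc n) t)
    decodeFormula n (node (leaf 7) t) = Maybe.map exists (decodeFormula (suc n) t)
    decodeFormula n _ = nothing

    decode-encodeFormula : ∀ {n} (φ : Formula σ AutAtom n) → decodeFormula n (encodeFormula φ) ≡ just φ
    decode-encodeFormula (extra P) = refl
    decode-encodeFormula (equal s t) rewrite decode-encodeTerm s | decode-encodeTerm t = refl
    decode-encodeFormula (atom r ts) rewrite decode-code rels r | decode-encodeTerms ts = refl
    decode-encodeFormula (not φ) rewrite decode-encodeFormula φ = refl
    decode-encodeFormula (and φ ψ) rewrite decode-encodeFormula φ | decode-encodeFormula ψ = refl
    decode-encodeFormula (or φ ψ) rewrite decode-encodeFormula φ | decode-encodeFormula ψ = refl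
    decode-encodeFormula (implies φ ψ) rewrite decode-encodeFormula φ | decode-encodeFormula ψ = refl
    decode-encodeFormula (all φ) rewrite decode-encodeFormula φ = refl
    decode-encodeFormula (exists φ) rewrite decode-encodeFormula φ = refl

    mutual
      encodeSkolem : SkolemTerm σ ℕ → Tree
      encodeSkolem (gen v)        = node (leaf 0) (leaf v)
      encodeSkolem (app f ts)     = node (leaf 1) (node (leaf (funCode f)) (encodeSkolems ts))
      -- The number n is recorded because decoding φ and ts requires it; for `app` the length comes
      -- from the symbol.
      encodeSkolem (wit {n} φ ts) = node (leaf 2) (node (leaf n) (node (encodeFormula φ) (encodeSkolems ts)))

      encodeSkolems : ∀ {k} → Vec (SkolemTerm σ ℕ) k → Tree
      encodeSkolems []       = leaf 0
      encodeSkolems (t ∷ ts) = node (encodeSkolem t) (encodeSkolems ts)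

    mutual
      decodeSkolem : Tree → Maybe (SkolemTerm σ ℕ)
      decodeSkolem (node (leaf 0) (leaf v)) = just (gen v)
      decodeSkolem (node (leaf 1) (node (leaf k) t)) =
        decode funs k >>= λ f → Maybe.map (app f) (decodeSkolems (funArity σ f) t)
      decodeSkolem (node (leaf 2) (node (leaf n) (node s t))) =
        zipWith wit (decodeFormula (suc n) s) (decodeSkolems n t)
      decodeSkolem _ = nothing

      decodeSkolems : ∀ k → Tree → Maybe (Vec (SkolemTerm σ ℕ) k)
      decodeSkolems zero    _          = just []
      decodeSkolems (suc k) (node s t) = zipWith _∷_ (decodeSkolem s) (decodeSkolems k t)
      decodeSkolems (suc k) (leaf _)   = nothing

    mutual
      decode-encodeSkolem : ∀ t → decodeSkolem (encodeSkolem t) ≡ just t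
      decode-encodeSkolem (gen v) = refl
      decode-encodeSkolem (app f ts) rewrite decode-code funs f | decode-encodeSkolems ts = refl
      decode-encodeSkolem (wit φ ts) rewrite decode-encodeFormula φ | decode-encodeSkolems ts = refl

      decode-encodeSkolems : ∀ {k} (ts : Vec (SkolemTerm σ ℕ) k) → decodeSkolems k (encodeSkolems ts) ≡ just ts
      decode-encodeSkolems []       = refl
      decode-encodeSkolems (t ∷ ts) rewrite decode-encodeSkolem t | decode-encodeSkolems ts = refl

    SkolemTerm-countable : Countable (SkolemTerm σ ℕ)
    SkolemTerm-countable = tree-coded encodeSkolem decodeSkolem decode-encodeSkolem

    Query-countable : Countable (Query σ)
    Query-countable = tree-coded encodeQuery decodeQuery decode-encodeQuery
      where
      encodeQuery : Query σ → Tree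
      encodeQuery (query m {n} φ ts) =
        node (leaf m) (node (leaf n) (node (encodeFormula φ) (encodeSkolems ts)))

      decodeQuery : Tree → Maybe (Query σ)
      decodeQuery (node (leaf m) (node (leaf n) (node s t))) =
        zipWith (query m) (decodeFormula n s) (decodeSkolems n t)
      decodeQuery _ = nothing

      decode-encodeQuery : ∀ q → decodeQuery (encodeQuery q) ≡ just q
      decode-encodeQuery (query m φ ts) rewrite decode-encodeFormula φ | decode-encodeSkolems ts = refl

  -- Increasing maps into unbounded sets

  module _ (O : StrictTotalOrder 0ℓ 0ℓ 0ℓ) where

    open StrictTotalOrder O using () renaming (Carrier to I)
    open Order O

    -- Enumerate a subset of A increasingly by e and send x to e of its position in the sorted F.
    embedding : ∀ F {A} → Unbounded A → Σ (I → ℕ) λ g → Embeds F g × ∀ x → A (g x)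
    embedding F {A} u = (λ x → e (position x (sort F))) ,
      (λ x∈F y∈F → (λ x≺y → e-mono (position-mono (sort-sorted F) (sort-⊇ x∈F) (sort-⊇ y∈F) x≺y))
                 , (λ x≋y → cong e (position-cong (sort F) x≋y))) ,
      λ x → e∈A (position x (sort F))
      where
      e : ℕ → ℕ
      e zero    = proj₁ (u 0)
      e (suc n) = proj₁ (u (suc (e n)))

      e∈A : ∀ n → A (e n)
      e∈A zero    = proj₂ (proj₂ (u 0))
      e∈A (suc n) = proj₂ (proj₂ (u (suc (e n))))

      e-mono : ∀ {m n} → m < n → e m < e n
      e-mono {m} {suc n} m<1+n with m ≟ n
      ... | yes refl = proj₁ (proj₂ (u (suc (e n))))
      ... | no m≢n   = <-trans (e-mono (≤∧≢⇒< (≤-pred m<1+n) m≢n)) (proj₁ (proj₂ (u (suc (e n)))))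

  -- Values of Skolem terms

  module _ {σ : Signature} where

    open Structure using (Carrier; inhabitant; fun)

    module _ (⟦_⟧ : AutAtom → Structure σ → Set) (M : Structure σ) where

      -- The Skolem functions need not respect `_≈_`: they are not symbols of σ, and only literally
      -- equal arguments are substituted into them.
      choose : ∀ {n} → Formula σ AutAtom (suc n) → Vec (Carrier M) n → Carrier M
      choose φ ρ with em {P = Σ (Carrier M) λ x → Sat ⟦_⟧ M (x ∷ ρ) φ}
      ... | yes (x , _) = x
      ... | no _        = inhabitant M

      choose-sat : ∀ {n} φ {ρ : Vec (Carrier M) n} → Sat ⟦_⟧ M ρ (exists φ) → Sat ⟦_⟧ M (choose φ ρ ∷ ρ) φ
      choose-sat φ {ρ} ex with em {P = Σ (Carrier M) λ x → Sat ⟦_⟧ M (x ∷ ρ) φ}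
      ... | yes (_ , sat) = sat
      ... | no none       = contradiction ex none

      mutual
        value : ∀ {V} → (V → Carrier M) → SkolemTerm σ V → Carrier M
        value e (gen v)    = e v
        value e (app f ts) = fun M f (values e ts)
        value e (wit φ ts) = choose φ (values e ts)

        values : ∀ {V n} → (V → Carrier M) → Vec (SkolemTerm σ V) n → Vec (Carrier M) n
        values e []       = []
        values e (t ∷ ts) = value e t ∷ values e ts

      module _ {V W : Set} {e : W → Carrier M} {e′ : V → Carrier M} {f : V → W} where
        mutual
          -- Agreement on the generators of t is all that is available when generators are replaced
          -- by positions in a finite list.
          value-rename : ∀ t → (∀ {v} → v ∈ generators t → e (f v) ≡ e′ v) →
            value e (rename f t) ≡ value e′ t
          value-rename (gen v)    eq = eq (here refl)
          value-rename (app g ts) eq = cong (fun M g) (values-rename ts eq)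
          value-rename (wit φ ts) eq = cong (choose φ) (values-rename ts eq)

          values-rename : ∀ {n} (ts : Vec (SkolemTerm σ V) n) →
            (∀ {v} → v ∈ generatorss ts → e (f v) ≡ e′ v) →
            values e (renames f ts) ≡ values e′ ts
          values-rename []       eq = refl
          values-rename (t ∷ ts) eq = cong₂ _∷_
            (value-rename t (λ v∈ → eq (∈-++⁺ˡ v∈)))
            (values-rename ts (λ v∈ → eq (∈-++⁺ʳ (generators t) v∈)))

      lookup-values : ∀ {V n} {e : V → Carrier M} (ts : Vec (SkolemTerm σ V) n) x →
        value e (lookup ts x) ≡ lookup (values e ts) x
      lookup-values (t ∷ ts) zero    = refl
      lookup-values (t ∷ ts) (suc x) = lookup-values ts x

  -- The limit structure and Łoś's theorem

  module Limit {σ : Signature} (countableσ : CountableSignature σ)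
    (⟦_⟧ : AutAtom → Structure σ → Set) (M : ℕ → Structure σ)
    (s : ∀ i → ℕ → Structure.Carrier (M i)) where

    open Structure using (Carrier; fun; fun-cong; rel; rel-cong; _≈_)

    abstract
      queries : Σ (ℕ → Query σ) λ e → ∀ q → Σ ℕ λ k → e k ≡ q
      queries = enumeration (Query-countable countableσ) (query 0 {0} (extra P) [])

    queryAt : ℕ → Query σ
    queryAt = proj₁ queries

    queryAt-surjective : ∀ q → Σ ℕ λ k → queryAt k ≡ q
    queryAt-surjective = proj₂ queries

    answer : ℕ → Query σ → List ℕ → Bool
    answer i (query _ φ ts) xs =
      ⌊ Sat ⟦_⟧ (M i) (values ⟦_⟧ (M i) (λ n → s i (nth xs n)) ts) φ ⌋

    abstract
      cluster : Σ (ℕ → Bool) λ T → ∀ K → Σ ℕ λ i → K ≤ i × Σ (Pred ℕ 0ℓ) λ A → Unbounded A ×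
        ∀ {k} → k < K → Homogeneous (Query.arity (queryAt k)) (answer i (queryAt k)) A (T k)
      cluster = homogeneous-cluster (λ k → Query.arity (queryAt k)) (λ i k → answer i (queryAt k))

    template : ℕ → Bool
    template = proj₁ cluster

    module _ (O : StrictTotalOrder 0ℓ 0ℓ 0ℓ) where

      open StrictTotalOrder O using () renaming (Carrier to I; _≈_ to _≋_; _<_ to _≺_)
      open Order O

      Point : Set
      Point = ℕ × (I → ℕ)

      -- The sets of near points form a filter base: they shrink as F and K grow, and `near-point`
      -- shows that none is empty.
      Near : List I → ℕ → Point → Set
      Near F K (i , g) = K ≤ i × Embeds F g ×
        (∀ {k} → k < K → ∀ xs → AllPairs _≺_ xs → All (_∈ F) xs →
          length xs ≡ Query.arity (queryAt k) → answer i (queryAt k) (map g xs) ≡ template k)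

      near-point : ∀ F K → Σ Point (Near F K)
      near-point F K
        with i , K≤i , A , unbounded , homogeneous ← proj₂ cluster K
        with g , embeds , g∈A ← embedding O F unbounded
        = (i , g) , K≤i , embeds , λ k<K xs sorted xs⊆F len →
            homogeneous k<K (map g xs) (embeds-sorted embeds xs⊆F sorted)
              (All.map⁺ (All.universal g∈A xs)) (trans (length-map g xs) len)

      near-antitone : ∀ {F F′ K K′ p} → (∀ {x} → x ∈ F → x ∈ F′) → K ≤ K′ → Near F′ K′ p → Near F K p
      near-antitone sub K≤K′ (K′≤i , embeds , agree) =
        ≤-trans K≤K′ K′≤i ,
        (λ x∈F y∈F → embeds (sub x∈F) (sub y∈F)) ,
        λ k<K xs sorted xs⊆F → agree (<-≤-trans k<K K≤K′) xs sorted (All.map sub xs⊆F)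

      -- Membership in the filter generated by the near sets. It takes the place of an ultrafilter:
      -- by `decide` it is ultra on the sets that formulas define.
      record Eventually (A : Point → Set) : Set where
        constructor eventually
        field
          support : List I
          bound   : ℕ
          near⇒   : ∀ p → Near support bound p → A p

      always : ∀ {A} → (∀ p → A p) → Eventually A
      always f = eventually [] 0 λ p _ → f p

      zip-eventually : ∀ {A B C} → (∀ p → A p → B p → C p) → Eventually A → Eventually B → Eventually C
      zip-eventually f (eventually F K a) (eventually F′ K′ b) = eventually (F ++ F′) (K ⊔ K′) λ p near →
        f p (a p (near-antitone ∈-++⁺ˡ (m≤m⊔n K K′) near))
            (b p (near-antitone (∈-++⁺ʳ F) (m≤n⊔m K K′) near))

      map-eventually : ∀ {A B} → (∀ p → A p → B p) → Eventually A → Eventually B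
      map-eventually f (eventually F K a) = eventually F K λ p near → f p (a p near)

      eventually-witness : ∀ {A} → Eventually A → Σ Point A
      eventually-witness (eventually F K a) with p , near ← near-point F K = p , a p near

      never : ¬ Eventually (λ _ → ⊥)
      never ev = proj₂ (eventually-witness ev)

      M⟨_⟩ : Point → Structure σ
      M⟨ i , _ ⟩ = M i

      at : (p : Point) → SkolemTerm σ I → Carrier M⟨ p ⟩
      at (i , g) = value ⟦_⟧ (M i) (λ x → s i (g x))

      ats : ∀ {n} (p : Point) → Vec (SkolemTerm σ I) n → Vec (Carrier M⟨ p ⟩) n
      ats (i , g) = values ⟦_⟧ (M i) (λ x → s i (g x))

      Holds : ∀ {n} → Formula σ AutAtom n → Vec (SkolemTerm σ I) n → Point → Set
      Holds φ ts p = Sat ⟦_⟧ M⟨ p ⟩ (ats p ts) φ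

      -- The formula φ(ts) amounts to one query about the sorted support of ts. Once the bound
      -- exceeds the index of that query, all near points give it the answer of the template.
      decide : ∀ {n} (φ : Formula σ AutAtom n) ts →
        Eventually (Holds φ ts) ⊎ Eventually (λ p → ¬ Holds φ ts p)
      decide φ ts = go (template k) refl
        where
        F : List I
        F = generatorss ts

        u : List I
        u = sort F

        q : Query σ
        -- Each generator becomes its position in u, so the answer to q on `map g u` is the truth of
        -- φ(ts) at (i , g).
        q = query (length u) φ (renames (λ x → position x u) ts)

        k : ℕ
        k = proj₁ (queryAt-surjective q)

        queryAt-k : queryAt k ≡ q
        queryAt-k = proj₂ (queryAt-surjective q)

        agree : ∀ p → Near F (suc k) p → ⌊ Holds φ ts p ⌋ ≡ template k
        agree p@(i , g) (_ , embeds , agrees) = begin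
          ⌊ Holds φ ts p ⌋
            ≡⟨ cong (λ ρ → ⌊ Sat ⟦_⟧ (M i) ρ φ ⌋) (sym (values-rename ⟦_⟧ (M i) ts λ x∈F →
                 cong (s i) (nth-position (sort-⊇ x∈F)
                   (λ y∈u → proj₂ (embeds x∈F (All.lookup (sort-⊆ F) y∈u)))))) ⟩
          answer i q (map g u)
            ≡⟨ cong (λ q → answer i q (map g u)) (sym queryAt-k) ⟩
          answer i (queryAt k) (map g u)
            ≡⟨ agrees ≤-refl u (sort-sorted F) (sort-⊆ F) (cong Query.arity (sym queryAt-k)) ⟩
          template k ∎
          where open ≡-Reasoning

        go : ∀ b → template k ≡ b → Eventually (Holds φ ts) ⊎ Eventually (λ p → ¬ Holds φ ts p)
        go true  eq = inj₁ (eventually F (suc k) λ p near → ⌊⌋-true⁻ (trans (agree p near) eq))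
        go false eq = inj₂ (eventually F (suc k) λ p near → ⌊⌋-false⁻ (trans (agree p near) eq))

      _≈ₗ_ : SkolemTerm σ I → SkolemTerm σ I → Set
      t ≈ₗ t′ = Eventually (λ p → _≈_ M⟨ p ⟩ (at p t) (at p t′))

      eventually-pointwise : ∀ {n} {ts ts′ : Vec (SkolemTerm σ I) n} → Pointwise _≈ₗ_ ts ts′ →
        Eventually (λ p → Pointwise (_≈_ M⟨ p ⟩) (ats p ts) (ats p ts′))
      eventually-pointwise []       = always λ _ → []
      eventually-pointwise (e ∷ es) = zip-eventually (λ _ → _∷_) e (eventually-pointwise es)

      limit : Structure σ
      limit = record
        { domain     = record
          { Carrier       = SkolemTerm σ I
          ; _≈_           = _≈ₗ_
          ; isEquivalence = record
            { refl  = always λ p → Structure.refl M⟨ p ⟩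
            ; sym   = map-eventually λ p → Structure.sym M⟨ p ⟩
            ; trans = zip-eventually λ p → Structure.trans M⟨ p ⟩
            }
          }
        -- A closed Skolem term exists even over an empty order and without constant symbols.
        ; inhabitant = wit {n = 0} (extra P) []
        ; fun        = app
        ; fun-cong   = λ f es → map-eventually (λ p → fun-cong M⟨ p ⟩ f) (eventually-pointwise es)
        ; rel        = λ r ts → Eventually (λ p → rel M⟨ p ⟩ r (ats p ts))
        ; rel-cong   = λ r es → zip-eventually (λ p → rel-cong M⟨ p ⟩ r) (eventually-pointwise es)
        }

      mutual
        at-eval : ∀ {n} p (ρ : Vec (SkolemTerm σ I) n) t → at p (eval limit ρ t) ≡ eval M⟨ p ⟩ (ats p ρ) t
        at-eval p ρ (var x)    = lookup-values ⟦_⟧ M⟨ p ⟩ ρ x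
        at-eval p ρ (app f ts) = cong (fun M⟨ p ⟩ f) (ats-evals p ρ ts)

        ats-evals : ∀ {n k} p (ρ : Vec (SkolemTerm σ I) n) (ts : Vec (Term σ n) k) →
          ats p (evals limit ρ ts) ≡ evals M⟨ p ⟩ (ats p ρ) ts
        ats-evals p ρ []       = refl
        ats-evals p ρ (t ∷ ts) = cong₂ _∷_ (at-eval p ρ t) (ats-evals p ρ ts)

      module _ (atoms : ∀ x → ⟦ x ⟧ limit ⇔ Eventually (λ p → ⟦ x ⟧ M⟨ p ⟩)) where

        open Equivalence using (to; from)

        -- As for ultraproducts, with `decide` as the ultrafilter property and Skolem terms as
        -- uniform witnesses for quantifiers. The transfer of P is not automatic and is supplied by
        -- `atoms`.
        łoś : ∀ {n} (φ : Formula σ AutAtom n) ρ → Sat ⟦_⟧ limit ρ φ ⇔ Eventually (Holds φ ρ)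
        łoś (extra x) ρ = atoms x
        łoś (equal t t′) ρ = mk⇔
          (map-eventually λ p → subst₂ (_≈_ M⟨ p ⟩) (at-eval p ρ t) (at-eval p ρ t′))
          (map-eventually λ p → subst₂ (_≈_ M⟨ p ⟩) (sym (at-eval p ρ t)) (sym (at-eval p ρ t′)))
        łoś (atom r ts) ρ = mk⇔
          (map-eventually λ p → subst (rel M⟨ p ⟩ r) (ats-evals p ρ ts))
          (map-eventually λ p → subst (rel M⟨ p ⟩ r) (sym (ats-evals p ρ ts)))
        łoś (not φ) ρ = mk⇔
          (λ ¬sat → [ (λ ev → contradiction (from (łoś φ ρ) ev) ¬sat) , (λ ev → ev) ]′ (decide φ ρ))
          (λ ev sat → never (zip-eventually (λ p ¬h → ¬h) ev (to (łoś φ ρ) sat)))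
        łoś (and φ ψ) ρ = mk⇔
          (λ (a , b) → zip-eventually (λ p → _,_) (to (łoś φ ρ) a) (to (łoś ψ ρ) b))
          (λ ev → from (łoś φ ρ) (map-eventually (λ p → proj₁) ev) ,
                  from (łoś ψ ρ) (map-eventually (λ p → proj₂) ev))
        łoś (or φ ψ) ρ = mk⇔
          [ (λ a → map-eventually (λ p → inj₁) (to (łoś φ ρ) a)) ,
            (λ b → map-eventually (λ p → inj₂) (to (łoś ψ ρ) b)) ]′
          (λ ev → [ (λ a → inj₁ (from (łoś φ ρ) a)) ,
                    (λ ¬a → inj₂ (from (łoś ψ ρ)
                      (zip-eventually (λ p ab ¬a → [ (λ a → contradiction a ¬a) , (λ b → b) ]′ ab) ev ¬a))) ]′
                  (decide φ ρ))
        łoś (implies φ ψ) ρ = mk⇔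
          (λ h → [ (λ a → map-eventually (λ p b _ → b) (to (łoś ψ ρ) (h (from (łoś φ ρ) a)))) ,
                   map-eventually (λ p ¬a a → contradiction a ¬a) ]′
                 (decide φ ρ))
          (λ ev sat → from (łoś ψ ρ) (zip-eventually (λ p h → h) ev (to (łoś φ ρ) sat)))
        łoś (all φ) ρ = mk⇔
          -- If `all φ` eventually fails, the Skolem term for `not φ` is eventually a
          -- counterexample, although h makes φ true of it.
          (λ h → [ (λ ev → ev) ,
                   (λ ev → ⊥-elim (never (zip-eventually counterexample ev
                     (to (łoś φ (wit (not φ) ρ ∷ ρ)) (h (wit (not φ) ρ)))))) ]′
                 (decide (all φ) ρ))
          (λ ev t → from (łoś φ (t ∷ ρ)) (map-eventually (λ p h → h (at p t)) ev))
          where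
          counterexample : ∀ p → ¬ Holds (all φ) ρ p → Holds φ (wit (not φ) ρ ∷ ρ) p → ⊥
          counterexample p ¬all = choose-sat ⟦_⟧ M⟨ p ⟩ (not φ)
            (by-contradiction λ none → ¬all λ x → by-contradiction λ ¬φ → none (x , ¬φ))
        łoś (exists φ) ρ = mk⇔
          (λ (t , sat) → map-eventually (λ p h → at p t , h) (to (łoś φ (t ∷ ρ)) sat))
          (λ ev → wit φ ρ , from (łoś φ (wit φ ρ ∷ ρ)) (map-eventually (λ p → choose-sat ⟦_⟧ M⟨ p ⟩ φ) ev))

      -- Automorphisms of the limit from automorphisms of the order

      record OrderAutomorphism : Set where
        field
          to        : I → I
          from      : I → I
          to-mono   : ∀ {x y} → x ≺ y → to x ≺ to y
          from-mono : ∀ {x y} → x ≺ y → from x ≺ from y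
          to-cong   : ∀ {x y} → x ≋ y → to x ≋ to y
          from-cong : ∀ {x y} → x ≋ y → from x ≋ from y
          -- Literal equality, stronger than `_≋_`, lets `rename-inverse` return the same term.
          from∘to   : ∀ x → from (to x) ≡ x
          to∘from   : ∀ x → to (from x) ≡ x

      module _ {τ : I → I} (mono : ∀ {x y} → x ≺ y → τ x ≺ τ y) (cong-τ : ∀ {x y} → x ≋ y → τ x ≋ τ y) where

        -- An increasing τ carries sorted lists in F to sorted lists in `map τ F`, so the template
        -- answers persist. Hence the filter is invariant under τ, and `rename τ` preserves eventual
        -- truth.
        near-∘ : ∀ {F K i g} → Near (map τ F) K (i , g) → Near F K (i , λ x → g (τ x))
        near-∘ {F} {i = i} {g} (K≤i , embeds , agree) = K≤i ,
          (λ x∈F y∈F → let lt , eq = embeds (∈-map⁺ τ x∈F) (∈-map⁺ τ y∈F) in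
            (λ x≺y → lt (mono x≺y)) , (λ x≋y → eq (cong-τ x≋y))) ,
          λ {k} k<K xs sorted xs⊆F len →
            trans (cong (answer i (queryAt k)) (map-∘ xs))
              (agree k<K (map τ xs) (AllPairs.map⁺ (AllPairs.map mono sorted))
                (All.map⁺ (All.map (∈-map⁺ τ) xs⊆F)) (trans (length-map τ xs) len))

        eventually-∘ : ∀ {A} → Eventually A → Eventually (λ (i , g) → A (i , λ x → g (τ x)))
        eventually-∘ (eventually F K a) = eventually (map τ F) K λ p near → a _ (near-∘ near)

        rename-cong : ∀ t t′ → t ≈ₗ t′ → rename τ t ≈ₗ rename τ t′
        rename-cong t t′ ev = map-eventually
          (λ (i , g) → subst₂ (_≈_ (M i))
            (sym (value-rename ⟦_⟧ (M i) t λ _ → refl)) (sym (value-rename ⟦_⟧ (M i) t′ λ _ → refl)))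
          (eventually-∘ ev)

        rename-rel : ∀ r {ts} → rel limit r ts → rel limit r (renames τ ts)
        rename-rel r {ts} ev = map-eventually
          (λ (i , g) → subst (rel (M i) r) (sym (values-rename ⟦_⟧ (M i) ts λ _ → refl)))
          (eventually-∘ ev)

      automorphism : OrderAutomorphism → Isomorphism limit limit
      automorphism τ = record
        { bijection = record
          { to        = rename to
          ; from      = rename from
          ; to-cong   = λ {t} {t′} → rename-cong to-mono to-cong t t′
          ; from-cong = λ {t} {t′} → rename-cong from-mono from-cong t t′
          ; inverse   =
              (λ {t} {u} eq → subst (rename to u ≈ₗ_) (rename-inverse to∘from t)
                (rename-cong to-mono to-cong u (rename from t) eq)) ,
              (λ {t} {u} eq → subst (rename from u ≈ₗ_) (rename-inverse from∘to t)
                (rename-cong from-mono from-cong u (rename to t) eq))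
          }
        ; fun-hom   = λ f ts → subst (λ us → app f (renames to ts) ≈ₗ app f us) (renames≡map to ts)
            (Structure.refl limit {app f (renames to ts)})
        ; rel-hom   = λ r ts → mk⇔
            (λ ev → subst (rel limit r) (renames≡map to ts) (rename-rel to-mono to-cong r ev))
            (λ ev → subst (rel limit r) (renames-inverse from∘to ts)
              (rename-rel from-mono from-cong r (subst (rel limit r) (sym (renames≡map to ts)) ev)))
        }
        where open OrderAutomorphism τ

      -- At a point near for the support enlarged by x and y, g is strictly increasing on these two,
      -- so an equality of sequence members with indices g x and g y leaves only x ≋ y.
      gen-injective : (∀ i {m n} → _≈_ (M i) (s i m) (s i n) → m ≡ n) →
        ∀ {x y} → gen x ≈ₗ gen y → x ≋ y
      gen-injective injective {x} {y} (eventually F K a) = distinct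
        where
        G : List I
        G = x ∷ y ∷ F

        distinct : x ≋ y
        distinct with (i , g) , near ← near-point G K
                 with gx≡gy ← injective i (a (i , g) (near-antitone (λ z∈F → there (there z∈F)) ≤-refl near))
                 with _ , embeds , _ ← near
                 with StrictTotalOrder.compare O x y
        ... | tri< x≺y _ _ = contradiction gx≡gy (<⇒≢ (proj₁ (embeds (here refl) (there (here refl))) x≺y))
        ... | tri≈ _ x≋y _ = x≋y
        ... | tri> _ _ y≺x = contradiction (sym gx≡gy) (<⇒≢ (proj₁ (embeds (there (here refl)) (here refl)) y≺x))

  -- Small and large automorphism groups

  module _ {σ : Signature} (M : Structure σ) where

    open Structure M using (Carrier; _≈_; inhabitant)
    open Isomorphism using (to; to-cong)

    -- An automorphism is determined by its graph on the enumerated elements, a subset of ℕ × ℕ read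
    -- through `unpair`. Repetitions in e are allowed, so finite structures are included.
    covered⇒small : (e : ℕ → Carrier) → (∀ x → Σ ℕ λ n → e n ≈ x) → ∣Aut M ∣≤2^ℵ₀
    covered⇒small e cover = record
      { to        = graph
      ; cong      = λ {a} {b} a≈b n → ⌊⌋-cong
          (Structure.trans M (Structure.sym M (a≈b _))) (Structure.trans M (a≈b _))
      ; injective = λ {a} {b} → graph-injective a b
      }
      where
      graph : Isomorphism M M → ℕ → Bool
      graph a n = let j , k = unpair n in ⌊ to a (e j) ≈ e k ⌋

      graph-injective : ∀ a b → graph a ≗ graph b → ∀ x → to a x ≈ to b x
      graph-injective a b eq x
        with j , ej≈x ← cover x
        with k , ek≈aej ← cover (to a (e j))
        with n , unpair-n ← unpair-surjective j k
        with eq-n ← eq n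
        rewrite unpair-n
        = Structure.trans M (to-cong a (Structure.sym M ej≈x))
            (Structure.trans M (Structure.sym M ek≈aej)
              (Structure.trans M
                (Structure.sym M (⌊⌋-true⁻ (trans (sym eq-n) (dec-true em (Structure.sym M ek≈aej)))))
                (to-cong b ej≈x)))

    -- A finite list covering the domain would make M small by `covered⇒small`. So every finite list
    -- misses an element, and these are collected one after another.
    large⇒infinite : ¬ ∣Aut M ∣≤2^ℵ₀ → Σ (ℕ → Carrier) λ s → ∀ {m n} → s m ≈ s n → m ≡ n
    large⇒infinite large = s , s-injective
      where
      entry : List Carrier → ℕ → Carrier
      entry []      n       = inhabitant
      entry (x ∷ F) zero    = x
      entry (x ∷ F) (suc n) = entry F n

      entry-covers : ∀ {F x} → Any (_≈ x) F → Σ ℕ λ n → entry F n ≈ x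
      entry-covers (here y≈x)  = 0 , y≈x
      entry-covers (there any) with n , eq ← entry-covers any = suc n , eq

      fresh : ∀ F → Σ Carrier λ x → ¬ Any (_≈ x) F
      fresh F = by-contradiction λ none → large
        (covered⇒small (entry F) λ x → entry-covers (by-contradiction λ x∉F → none (x , x∉F)))

      earlier : ℕ → List Carrier
      earlier zero    = []
      earlier (suc n) = proj₁ (fresh (earlier n)) ∷ earlier n

      s : ℕ → Carrier
      s n = proj₁ (fresh (earlier n))

      s∈earlier : ∀ {m n} → m < n → Any (_≈ s m) (earlier n)
      s∈earlier {m} {suc n} m<1+n with m ≟ n
      ... | yes refl = here (Structure.refl M)
      ... | no m≢n   = there (s∈earlier (≤∧≢⇒< (≤-pred m<1+n) m≢n))

      distinct : ∀ {m n} → m < n → ¬ s m ≈ s n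
      distinct {m} {n} m<n eq = proj₂ (fresh (earlier n))
        (Any.map (λ y≈sm → Structure.trans M y≈sm eq) (s∈earlier m<n))

      s-injective : ∀ {m n} → s m ≈ s n → m ≡ n
      s-injective {m} {n} eq with <-cmp m n
      ... | tri< m<n _ _ = contradiction eq (distinct m<n)
      ... | tri≈ _ m≡n _ = m≡n
      ... | tri> _ _ n<m = contradiction (Structure.sym M eq) (distinct n<m)

  -- The lexicographic order on 2^ℕ

  _<₂_ : (ℕ → Bool) → (ℕ → Bool) → Set
  c <₂ d = Σ ℕ λ n → (∀ m → m < n → c m ≡ d m) × c n ≡ false × d n ≡ true

  first-difference : ∀ (c d : ℕ → Bool) → ¬ c ≗ d → Σ ℕ λ n → (∀ m → m < n → c m ≡ d m) × c n ≢ d n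
  first-difference c d c≢d = by-contradiction λ none → c≢d λ n → agree none (suc n) n (n<1+n n)
    where
    agree : ¬ (Σ ℕ λ n → (∀ m → m < n → c m ≡ d m) × c n ≢ d n) → ∀ n m → m < n → c m ≡ d m
    agree none (suc n) m m<1+n with m ≟ n
    ... | yes refl = by-contradiction λ ne → none (m , agree none m , ne)
    ... | no m≢n   = agree none n m (≤∧≢⇒< (≤-pred m<1+n) m≢n)

  <₂-irrefl : ∀ {c d} → c ≗ d → ¬ c <₂ d
  <₂-irrefl c≗d (n , _ , cn , dn) with () ← trans (sym cn) (trans (c≗d n) dn)

  <₂-trans : ∀ {c d e} → c <₂ d → d <₂ e → c <₂ e
  <₂-trans (m , c=d , cm , dm) (n , d=e , dn , en) with <-cmp m n
  ... | tri< m<n _ _  = m , (λ k k<m → trans (c=d k k<m) (d=e k (<-trans k<m m<n))) ,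
                        cm , trans (sym (d=e m m<n)) dm
  ... | tri≈ _ refl _ with () ← trans (sym dm) dn
  ... | tri> _ _ n<m  = n , (λ k k<n → trans (c=d k (<-trans k<n n<m)) (d=e k k<n)) ,
                        trans (c=d n n<m) dn , en

  <₂-compare : Trichotomous _≗_ _<₂_
  <₂-compare c d with em {P = c ≗ d}
  ... | yes c≗d = tri≈ (<₂-irrefl c≗d) c≗d (<₂-irrefl (λ n → sym (c≗d n)))
  ... | no c≢d with n , agree , differ ← first-difference c d c≢d with c n in cn | d n in dn
  ...   | false | false = contradiction refl differ
  ...   | true  | true  = contradiction refl differ
  ...   | false | true  = tri< c<d c≢d (λ d<c → <₂-irrefl (λ _ → refl) (<₂-trans c<d d<c))
    where c<d = n , agree , cn , dn
  ...   | true  | false = tri> (λ c<d → <₂-irrefl (λ _ → refl) (<₂-trans c<d d<c)) c≢d d<c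
    where d<c = n , (λ m m<n → sym (agree m m<n)) , dn , cn

  continuum-order : StrictTotalOrder 0ℓ 0ℓ 0ℓ
  continuum-order = record
    { isStrictTotalOrder = isStrictTotalOrderᶜ record
      { isEquivalence = Setoid.isEquivalence Continuum
      ; trans         = <₂-trans
      ; compare       = <₂-compare
      }
    }

  -- Cantor's theorem for functions on 2^ℕ

  Extensional : ((ℕ → Bool) → ℤ) → Set
  Extensional δ = ∀ {c d} → c ≗ d → δ c ≡ δ d

  -- Diagonalisation: δ₀ is 1 at the codes of those δ that vanish at their own code, and 0
  -- elsewhere. At its own code δ₀ can then be neither 0 nor 1.
  cantor : (code : ∀ δ → Extensional δ → ℕ → Bool) →
    ¬ (∀ δ (ext : Extensional δ) δ′ (ext′ : Extensional δ′) → code δ ext ≗ code δ′ ext′ → ∀ c → δ c ≡ δ′ c)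
  cantor code code-injective = refute ⌊ Diagonal c₀ ⌋ refl
    where
    Diagonal : (ℕ → Bool) → Set
    Diagonal c = Σ ((ℕ → Bool) → ℤ) λ δ → Σ (Extensional δ) λ ext → code δ ext ≗ c × δ c ≡ ℤ.0ℤ

    diagonal-cong : ∀ {c d} → c ≗ d → Diagonal c → Diagonal d
    diagonal-cong c≗d (δ , ext , eq , δc≡0) =
      δ , ext , (λ n → trans (eq n) (c≗d n)) , trans (sym (ext c≗d)) δc≡0

    indicator : Bool → ℤ
    indicator b = if b then ℤ.1ℤ else ℤ.0ℤ

    δ₀ : (ℕ → Bool) → ℤ
    δ₀ c = indicator ⌊ Diagonal c ⌋

    ext₀ : Extensional δ₀
    ext₀ {c} {d} c≗d = cong indicator
      (⌊⌋-cong {A = Diagonal c} {Diagonal d} (diagonal-cong c≗d) (diagonal-cong (λ n → sym (c≗d n))))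

    c₀ : ℕ → Bool
    c₀ = code δ₀ ext₀

    refute : ∀ b → ⌊ Diagonal c₀ ⌋ ≡ b → ⊥
    refute true eq with δ , ext , same , δc₀≡0 ← ⌊⌋-true⁻ eq
                   with () ← trans (sym (cong indicator eq))
                               (trans (sym (code-injective δ ext δ₀ ext₀ same c₀)) δc₀≡0)
    refute false eq = ⌊⌋-false⁻ eq (δ₀ , ext₀ , (λ _ → refl) , cong indicator eq)

  -- 2^ℕ × ℤ ordered lexicographically: each fibre {c} × ℤ can be shifted
  -- independently of the others.
  fibred-order : StrictTotalOrder 0ℓ 0ℓ 0ℓ
  fibred-order = ×-strictTotalOrder continuum-order ℤ.<-strictTotalOrder

  -- Shifts of the fibres of 2^ℕ × ℤ

  module _ {σ : Signature} (countableσ : CountableSignature σ)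
    (⟦_⟧ : AutAtom → Structure σ → Set) (M : ℕ → Structure σ)
    (s : ∀ i → ℕ → Structure.Carrier (M i))
    (s-injective : ∀ i {m n} → Structure._≈_ (M i) (s i m) (s i n) → m ≡ n) where

    open Limit countableσ ⟦_⟧ M s

    shift-mono : ∀ δ → Extensional δ → ∀ {x y} → StrictTotalOrder._<_ fibred-order x y →
      StrictTotalOrder._<_ fibred-order (proj₁ x , proj₂ x ℤ.+ δ (proj₁ x)) (proj₁ y , proj₂ y ℤ.+ δ (proj₁ y))
    shift-mono δ ext (inj₁ c<d) = inj₁ c<d
    shift-mono δ ext {c , z} {d , w} (inj₂ (c≗d , z<w)) =
      inj₂ (c≗d , subst (λ v → z ℤ.+ δ c ℤ.< w ℤ.+ v) (ext c≗d) (ℤ.+-monoˡ-< (δ c) z<w))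

    shift-cong : ∀ δ → Extensional δ → ∀ {x y} → StrictTotalOrder._≈_ fibred-order x y →
      StrictTotalOrder._≈_ fibred-order (proj₁ x , proj₂ x ℤ.+ δ (proj₁ x)) (proj₁ y , proj₂ y ℤ.+ δ (proj₁ y))
    shift-cong δ ext (c≗d , z≡w) = c≗d , cong₂ ℤ._+_ z≡w (ext c≗d)

    shift : ∀ δ → Extensional δ → OrderAutomorphism fibred-order
    shift δ ext = record
      { to        = λ (c , z) → c , z ℤ.+ δ c
      ; from      = λ (c , z) → c , z ℤ.+ ℤ.- δ c
      ; to-mono   = shift-mono δ ext
      ; from-mono = shift-mono (λ c → ℤ.- δ c) (λ c≗d → cong ℤ.-_ (ext c≗d))
      ; to-cong   = shift-cong δ ext
      ; from-cong = shift-cong (λ c → ℤ.- δ c) (λ c≗d → cong ℤ.-_ (ext c≗d))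
      ; from∘to   = λ (c , z) → cong (c ,_) (trans (ℤ.+-assoc z (δ c) (ℤ.- δ c))
          (trans (cong (λ v → z ℤ.+ v) (ℤ.+-inverseʳ (δ c))) (ℤ.+-identityʳ z)))
      ; to∘from   = λ (c , z) → cong (c ,_) (trans (ℤ.+-assoc z (ℤ.- δ c) (δ c))
          (trans (cong (λ v → z ℤ.+ v) (ℤ.+-inverseˡ (δ c))) (ℤ.+-identityʳ z)))
      }

    -- The generator at (c , 0) is moved to the one at (c , δ c), and distinct generators stay
    -- distinct in the limit, so δ c can be read off.
    shift-injective : ∀ δ (ext : Extensional δ) δ′ (ext′ : Extensional δ′) →
      (∀ t → _≈ₗ_ fibred-order
        (Isomorphism.to (automorphism fibred-order (shift δ ext)) t)
        (Isomorphism.to (automorphism fibred-order (shift δ′ ext′)) t)) →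
      ∀ c → δ c ≡ δ′ c
    shift-injective δ ext δ′ ext′ same c = trans (sym (ℤ.+-identityˡ (δ c)))
      (trans (proj₂ (gen-injective fibred-order s-injective
               {c , ℤ.0ℤ ℤ.+ δ c} {c , ℤ.0ℤ ℤ.+ δ′ c} (same (gen (c , ℤ.0ℤ)))))
             (ℤ.+-identityˡ (δ′ c)))

    -- An injection of the automorphism group into 2^ℕ would code every extensional δ by its shift,
    -- against `cantor`.
    limit-large : ¬ ∣Aut limit fibred-order ∣≤2^ℵ₀
    limit-large J = cantor
      (λ δ ext → Injection.to J (automorphism fibred-order (shift δ ext)))
      (λ δ ext δ′ ext′ eq → shift-injective δ ext δ′ ext′
        (Injection.injective J {automorphism fibred-order (shift δ ext)}
          {automorphism fibred-order (shift δ′ ext′)} eq))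

  -- The logic L(σ)

  module _ {σ : Signature} where

    open Equivalence using () renaming (to to ⇒; from to ⇐)

    embed : ∀ {n} → Formula σ ⊥ n → Formula σ AutAtom n
    embed (equal s t)   = equal s t
    embed (atom r ts)   = atom r ts
    embed (not φ)       = not (embed φ)
    embed (and φ ψ)     = and (embed φ) (embed ψ)
    embed (or φ ψ)      = or (embed φ) (embed ψ)
    embed (implies φ ψ) = implies (embed φ) (embed ψ)
    embed (all φ)       = all (embed φ)
    embed (exists φ)    = exists (embed φ)

    module _ (⟦_⟧ : AutAtom → Structure σ → Set) (M : Structure σ) where

      embed-sat : ∀ {n} (ρ : Vec (Structure.Carrier M) n) φ → Sat ⟦_⟧⁰ M ρ φ ⇔ Sat ⟦_⟧ M ρ (embed φ)
      embed-sat ρ (equal s t)   = mk⇔ id id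
      embed-sat ρ (atom r ts)   = mk⇔ id id
      embed-sat ρ (not φ)       = mk⇔ (_∘ ⇐ (embed-sat ρ φ)) (_∘ ⇒ (embed-sat ρ φ))
      embed-sat ρ (and φ ψ)     = mk⇔
        (Product.map (⇒ (embed-sat ρ φ)) (⇒ (embed-sat ρ ψ)))
        (Product.map (⇐ (embed-sat ρ φ)) (⇐ (embed-sat ρ ψ)))
      embed-sat ρ (or φ ψ)      = mk⇔
        (Sum.map (⇒ (embed-sat ρ φ)) (⇒ (embed-sat ρ ψ)))
        (Sum.map (⇐ (embed-sat ρ φ)) (⇐ (embed-sat ρ ψ)))
      embed-sat ρ (implies φ ψ) = mk⇔
        (λ h → ⇒ (embed-sat ρ ψ) ∘ h ∘ ⇐ (embed-sat ρ φ))
        (λ h → ⇐ (embed-sat ρ ψ) ∘ h ∘ ⇒ (embed-sat ρ φ))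
      embed-sat ρ (all φ)       = mk⇔
        (λ h x → ⇒ (embed-sat (x ∷ ρ) φ) (h x))
        (λ h x → ⇐ (embed-sat (x ∷ ρ) φ) (h x))
      embed-sat ρ (exists φ)    = mk⇔
        (λ (x , h) → x , ⇒ (embed-sat (x ∷ ρ) φ) h)
        (λ (x , h) → x , ⇐ (embed-sat (x ∷ ρ) φ) h)

    L≥FO : L σ ≥ FO σ
    L≥FO K (φ , expresses) = embed φ , λ M → mk⇔
      (⇒ (embed-sat ⟦_⟧ᴬ M [] φ) ∘ ⇒ (expresses M))
      (⇐ (expresses M) ∘ ⇐ (embed-sat ⟦_⟧ᴬ M [] φ))

    -- A countably infinite structure for an arbitrary signature: small by enumeration, with the
    -- identity as an injective sequence.
    trivial-structure : Structure σ
    trivial-structure = record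
      { domain     = setoid ℕ
      ; inhabitant = 0
      ; fun        = λ _ _ → 0
      ; fun-cong   = λ _ _ → refl
      ; rel        = λ _ _ → ⊥
      ; rel-cong   = λ _ _ ()
      }

    trivial-small : ∣Aut trivial-structure ∣≤2^ℵ₀
    trivial-small = covered⇒small trivial-structure id λ n → n , refl

    module _ (countableσ : CountableSignature σ) where

      -- A first-order sentence for smallness would hold in `trivial-structure`, hence by `łoś` in
      -- its limit over `fibred-order`, which is large.
      smallness-not-FO : ¬ Expressible (FO σ) ∣Aut_∣≤2^ℵ₀
      smallness-not-FO (φ , expresses) = limit-large countableσ ⟦_⟧ (λ _ → trivial-structure) (λ _ → id) (λ _ → id)
        (⇐ (expresses _) (⇐ (embed-sat ⟦_⟧ _ [] φ) (⇐ (łoś fibred-order atoms (embed φ) [])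
          (always fibred-order λ _ → ⇒ (embed-sat ⟦_⟧ trivial-structure [] φ)
            (⇒ (expresses trivial-structure) trivial-small)))))
        where
        -- P, read as smallness, would not pass to the limit; it does not occur in
        -- embed φ, so it may be read as false.
        ⟦_⟧ : AutAtom → Structure σ → Set
        ⟦ _ ⟧ _ = ⊥

        open Limit countableσ ⟦_⟧ (λ _ → trivial-structure) (λ _ → id)

        atoms : ∀ x → ⟦ x ⟧ (limit fibred-order) ⇔ Eventually fibred-order (λ _ → ⊥)
        atoms _ = mk⇔ ⊥-elim (never fibred-order)

      L>FO : L σ > FO σ
      L>FO = L≥FO , ∣Aut_∣≤2^ℵ₀ , (extra P , λ _ → mk⇔ id id) , smallness-not-FO

      -- Compactness

      module _ (Φ : Pred (Formula σ AutAtom 0) 0ℓ) (countableΦ : CountableSubset {σ} Φ) where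

        Models : Structure σ → List (Formula σ AutAtom 0) → Set
        Models M = All (Sat ⟦_⟧ᴬ M [])

        code : Formula σ AutAtom 0 → ℕ
        code = proj₁ countableΦ

        prefix : ℕ → List (Formula σ AutAtom 0)
        prefix zero    = []
        prefix (suc n) with em {P = Σ _ λ φ → Φ φ × code φ ≡ n}
        ... | yes (φ , _) = φ ∷ prefix n
        ... | no _        = prefix n

        prefix-⊆ : ∀ n → All Φ (prefix n)
        prefix-⊆ zero    = []
        prefix-⊆ (suc n) with em {P = Σ _ λ φ → Φ φ × code φ ≡ n}
        ... | yes (_ , φ∈Φ , _) = φ∈Φ ∷ prefix-⊆ n
        ... | no _              = prefix-⊆ n

        ∈-prefix : ∀ {φ n} → Φ φ → code φ < n → φ ∈ prefix n
        ∈-prefix {φ} {suc n} φ∈Φ lt with em {P = Σ _ λ φ → Φ φ × code φ ≡ n} | code φ ≟ n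
        -- The sentence found at this code is φ itself, because codes are injective on Φ.
        ... | yes (_ , ψ∈Φ , eq) | yes refl = here (proj₂ countableΦ φ∈Φ ψ∈Φ (sym eq))
        ... | no none            | yes eq   = contradiction (φ , φ∈Φ , eq) none
        ... | yes _              | no ne    = there (∈-prefix φ∈Φ (≤∧≢⇒< (≤-pred lt) ne))
        ... | no _               | no ne    = ∈-prefix φ∈Φ (≤∧≢⇒< (≤-pred lt) ne)

        module _ (M : ℕ → Structure σ) (models : ∀ n → Models (M n) (prefix n))
          (s : ∀ i → ℕ → Structure.Carrier (M i)) (O : StrictTotalOrder 0ℓ 0ℓ 0ℓ) where

          open Limit countableσ ⟦_⟧ᴬ M s

          limit-model : (∀ x → ⟦ x ⟧ᴬ (limit O) ⇔ Eventually O (λ p → ⟦ x ⟧ᴬ (M (proj₁ p)))) →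
            HasModel (L σ) Φ
          limit-model atoms = limit O , λ φ φ∈Φ → ⇐ (łoś O atoms φ [])
            -- This bound makes the index of the structure exceed the code of φ, so φ belongs to the
            -- prefix that the structure satisfies.
            (eventually [] (suc (code φ)) λ p near →
              All.lookup (models (proj₁ p)) (∈-prefix φ∈Φ (proj₁ near)))

        -- With generators from ℕ there are only countably many Skolem terms, so the limit is small
        -- and P is true on both sides of the transfer.
        small-case : (∀ φs → All Φ φs → Σ (Structure σ) λ M → Models M φs × ∣Aut M ∣≤2^ℵ₀) →
          HasModel (L σ) Φ
        small-case satisfiable = limit-model M models s <-strictTotalOrder λ where
            P → mk⇔ (λ _ → always <-strictTotalOrder λ p → small (proj₁ p)) (λ _ → limit-small)
          where
          choice : ∀ n → Σ (Structure σ) λ M → Models M (prefix n) × ∣Aut M ∣≤2^ℵ₀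
          choice n = satisfiable (prefix n) (prefix-⊆ n)

          M : ℕ → Structure σ
          M n = proj₁ (choice n)

          models : ∀ n → Models (M n) (prefix n)
          models n = proj₁ (proj₂ (choice n))

          small : ∀ n → ∣Aut M n ∣≤2^ℵ₀
          small n = proj₂ (proj₂ (choice n))

          s : ∀ i → ℕ → Structure.Carrier (M i)
          -- A constant sequence, since the M i may be finite.
          s i _ = Structure.inhabitant (M i)

          open Limit countableσ ⟦_⟧ᴬ M s

          terms : Σ (ℕ → SkolemTerm σ ℕ) λ e → ∀ t → Σ ℕ λ n → e n ≡ t
          terms = enumeration (SkolemTerm-countable countableσ) (gen 0)

          limit-small : ∣Aut limit <-strictTotalOrder ∣≤2^ℵ₀
          limit-small = covered⇒small (limit <-strictTotalOrder) (proj₁ terms) λ t →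
            let n , eq = proj₂ terms t in
            n , subst (λ u → _≈ₗ_ <-strictTotalOrder u t) (sym eq)
                  (Structure.refl (limit <-strictTotalOrder) {t})

        -- Large structures admit injective sequences, so the limit over `fibred-order` is large and
        -- P is false on both sides of the transfer.
        large-case : (∀ φs → All Φ φs → Σ (Structure σ) λ M → Models M φs × ¬ ∣Aut M ∣≤2^ℵ₀) →
          HasModel (L σ) Φ
        large-case satisfiable = limit-model M models s fibred-order λ where
            P → mk⇔ (λ small → contradiction small (limit-large countableσ ⟦_⟧ᴬ M s s-injective))
                    (λ ev → let p , small = eventually-witness fibred-order ev in
                            contradiction small (large (proj₁ p)))
          where
          choice : ∀ n → Σ (Structure σ) λ M → Models M (prefix n) × ¬ ∣Aut M ∣≤2^ℵ₀
          choice n = satisfiable (prefix n) (prefix-⊆ n)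

          M : ℕ → Structure σ
          M n = proj₁ (choice n)

          models : ∀ n → Models (M n) (prefix n)
          models n = proj₁ (proj₂ (choice n))

          large : ∀ n → ¬ ∣Aut M n ∣≤2^ℵ₀
          large n = proj₂ (proj₂ (choice n))

          s : ∀ i → ℕ → Structure.Carrier (M i)
          s i = proj₁ (large⇒infinite (M i) (large i))

          s-injective : ∀ i {m n} → Structure._≈_ (M i) (s i m) (s i n) → m ≡ n
          s-injective i = proj₂ (large⇒infinite (M i) (large i))

          open Limit countableσ ⟦_⟧ᴬ M s

        compact : (∀ φs → All Φ φs → Σ (Structure σ) λ M → Models M φs) → HasModel (L σ) Φ
        compact satisfiable with em {P = ∀ φs → All Φ φs → Σ (Structure σ) λ M → Models M φs × ∣Aut M ∣≤2^ℵ₀}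
        ... | yes small = small-case small
        -- If φs had no large model, any model of φs ++ ψs would be small, so every finite part ψs
        -- would have a small model.
        ... | no ¬small = large-case λ φs φs⊆Φ → by-contradiction λ none →
          ¬small λ ψs ψs⊆Φ →
            let M , models = satisfiable (φs ++ ψs) (All.++⁺ φs⊆Φ ψs⊆Φ)
                modelsφ , modelsψ = All.++⁻ φs models
            in M , modelsψ , by-contradiction λ large → none (M , modelsφ , large)

theorem6p1 : (∀ {ℓ} → ExcludedMiddle ℓ) →
    (σ : Signature) → CountableSignature σ →
    L σ > FO σ × ℵ₀-Compact (L σ)
theorem6p1 em σ countableσ = L>FO countableσ , compact countableσ
  where open Classical em
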